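{- Let $\lambda=(\lambda_{\overline2},\lambda_{\overline1})$ be a partition, i.e. $\lambda_{\overline2}\ge\lambda_{\overline1}\ge0$ are integers. 1. Regarding $\lambda$ as an element of $P^+_{C_2}$, $$K^{C_2}_{\lambda,0}(q)=\begin{cases} q^{\frac{\lambda_{\overline2}+\lambda_{\overline1}}2}\left(\dfrac{q^{\lambda_{\overline1}+2}-1}{q^2-1}+q^2\cdot\dfrac{q^{\lambda_{\overline1}+1}-1}{q-1}\cdot\dfrac{q^{\lambda_{\overline2}-\lambda_{\overline1}}-1}{q^2-1}\right)&\text{if }\lambda_{\overline2}\text{ and }\lambda_{\overline1}\text{ are even},\\[2mm] q^{\frac{\lambda_{\overline2}+\lambda_{\overline1}}2+1}\left(\dfrac{q^{\lambda_{\overline1}+1}-1}{q^2-1}+q\cdot\dfrac{q^{\lambda_{\overline1}+1}-1}{q-1}\cdot\dfrac{q^{\lambda_{\overline2}-\lambda_{\overline1}}-1}{q^2-1}\right)&\text{if }\lambda_{\overline2}\text{ and }\lambda_{\overline1}\text{ are odd},\\[2mm] 0&\text{otherwise.}\end{cases}$$ 2. Regarding $\lambda$ as an element of $P^+_{B_2}$, $$K^{B_2}_{\lambda,0}(q)=\begin{cases} q^{\lambda_{\overline2}}\left(\dfrac{q^{2\lambda_{\overline1}+2}-1}{q^2-1}+q^2\cdot\dfrac{q^{2\lambda_{\overline1}+1}-1}{q-1}\cdot\dfrac{q^{\lambda_{\overline2}-\lambda_{\overline1}}-1}{q^2-1}\right)&\text{if }\lambda_{\overline2}+\lambda_{\overline1}\text{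 is even},\\[2mm] q^{\lambda_{\overline2}+1}\cdot\dfrac{q^{2\lambda_{\overline1}+1}-1}{q-1}\cdot\dfrac{q^{\lambda_{\overline2}-\lambda_{\overline1}+1}-1}{q^2-1}&\text{otherwise.}\end{cases}$$
   Context: Write $\beta=(\beta_{\overline2},\beta_{\overline1})$ for $\beta_{\overline2}\varepsilon_{\overline2}+\beta_{\overline1}\varepsilon_{\overline1}$, with $\varepsilon_{\overline1},\varepsilon_{\overline2}$ an orthonormal basis of $\mathbb R^2$. The positive roots of $B_2$ ($so_5$) are $\varepsilon_{\overline2}\pm\varepsilon_{\overline1},\varepsilon_{\overline1},\varepsilon_{\overline2}$, with $\rho=(\frac32,\frac12)$; those of $C_2$ ($sp_4$) are $\varepsilon_{\overline2}\pm\varepsilon_{\overline1},2\varepsilon_{\overline1},2\varepsilon_{\overline2}$, with $\rho=(2,1)$. $P^+_{B_2}$ and $P^+_{C_2}$ denote the dominant weights. The Weyl group $W$ is the group of the $8$ signed permutations of the coordinates, with length $l$. The $q$-partition function is defined by $\prod_{\alpha\in R^+}\frac1{1-qx^\alpha}=\sum_\beta\mathcal P_q(\beta)x^\beta$ ($\mathcal P_q(\beta)=0$ if $\beta$ is not a nonnegative integral combination of positive roots), and $K_{\lambda,\mu}(q)=\sum_{\sigma\in W}(-1)^{l(\sigma)}\mathcal P_q(\sigma(\lambda+\rho)-(\mu+\rho))$. -}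

module Defs where

open import Algebra.Bundles.Raw using (RawRing)
import Algebra.Definitions.RawMonoid as RawMonoidDefs
import Algebra.Definitions.RawSemiring as RawSemiringDefs
open import Algebra.Properties.Group using (⁻¹-involutive)
open import Algebra.Properties.Monoid.Sum using (sum-cong-≗)
open import Data.Bool.Base using (Bool; true; false; if_then_else_; _xor_)
open import Data.Fin.Base using (Fin; zero; suc; toℕ)
open import Data.Integer.Base as ℤ using (ℤ; 0ℤ; 1ℤ; -1ℤ)
import Data.Integer.Properties as ℤ
open import Data.Integer.Solver using (module +-*-Solver)
open import Data.List.Base
  using (List; []; _∷_; _++_; map; foldr; length; cartesianProduct; cartesianProductWith)
open import Data.Nat.Base as ℕ using (ℕ; zero; suc; z≤n; s≤s)
import Data.Nat.Properties as ℕ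
open import Data.Product.Base using (_×_; _,_)
open import Data.Product.Properties using (≡-dec)
open import Data.Rational.Base as ℚ using (ℚ; 0ℚ; 1ℚ; ½)
import Data.Rational.Properties as ℚ
open import Data.Sign.Base as Sign using (Sign)
open import Data.Vec.Base using (Vec; []; _∷_; head; lookup)
open import Level using (0ℓ)
open import Relation.Binary.Definitions using (DecidableEquality)
open import Relation.Binary.PropositionalEquality
  using (_≡_; refl; sym; trans; cong; cong₂; module ≡-Reasoning)
open import Relation.Nullary.Decidable using (does; toWitness)

module PowerSeries {c ℓ} (R : RawRing c ℓ) where
  open RawRing R
  open RawMonoidDefs +-rawMonoid using (sum)
  open RawSemiringDefs rawSemiring using (_^_)

  powerSeries : RawRing c ℓ
  powerSeries = record
    { Carrier = ℕ → Carrier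
    ; _≈_     = λ f g → ∀ n → f n ≈ g n
    ; _+_     = λ f g n → f n + g n
    ; _*_     = λ f g n → sum {suc n} λ i → f (toℕ i) * g (n ℕ.∸ toℕ i)
    ; -_      = λ f n → - f n
    ; 0#      = λ _ → 0#
    ; 1#      = λ { zero → 1# ; (suc _) → 0# }
    }

  -- The series a q.
  linear : Carrier → (ℕ → Carrier)
  linear a zero          = 0#
  linear a (suc zero)    = a
  linear a (suc (suc _)) = 0#

  -- The series 1 / (1 - a q).
  geometric : Carrier → (ℕ → Carrier)
  geometric a n = a ^ n

-- ℤ[q] and the rational functions whose denominator has constant term
-- ±1 embed in ℤ⟦q⟧, so identities between them may be stated there.

ℤ⟦q⟧ : RawRing 0ℓ 0ℓ
ℤ⟦q⟧ = PowerSeries.powerSeries ℤ.+-*-rawRing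

open RawRing ℤ⟦q⟧ public using (_≈_; _+_; _*_; -_; 0#; 1#) renaming (Carrier to Series)
open RawSemiringDefs (RawRing.rawSemiring ℤ⟦q⟧) public using (_^_)

infixl 6 _-_
_-_ : Series → Series → Series
f - g = f + - g

q : Series
q = PowerSeries.linear ℤ.+-*-rawRing 1ℤ

data IsUnit : ℤ → Set where
  instance
    +1-unit : IsUnit 1ℤ
    -1-unit : IsUnit -1ℤ

open RawMonoidDefs ℤ.+-0-rawMonoid using () renaming (sum to sumℤ)

-- The coefficients of f / g in degrees n , … , 1 , 0, obtained by
-- solving g * h ≈ f.  A unit of ℤ is its own inverse, so the division
-- by the constant term of g is a multiplication.

quotients : (f g : Series) (n : ℕ) → Vec ℤ (suc n)
quotients f g zero    = (g 0 ℤ.* f 0) ∷ []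
quotients f g (suc n) =
  (g 0 ℤ.* (f (suc n) ℤ.- sumℤ λ i → g (suc (toℕ i)) ℤ.* lookup hs i)) ∷ hs
  where
  hs : Vec ℤ (suc n)
  hs = quotients f g n

infixl 7 _/_
_/_ : (f g : Series) → {{IsUnit (g 0)}} → Series
(f / g) n = head (quotients f g n)

private
  unit²≡1 : ∀ {u} → IsUnit u → u ℤ.* u ≡ 1ℤ
  unit²≡1 +1-unit = refl
  unit²≡1 -1-unit = refl

  lookup-quotients : ∀ f g n (i : Fin (suc n)) →
                     lookup (quotients f g n) i ≡ head (quotients f g (n ℕ.∸ toℕ i))
  lookup-quotients f g zero    zero    = refl
  lookup-quotients f g (suc n) zero    = refl
  lookup-quotients f g (suc n) (suc i) = lookup-quotients f g n i

  unit-cancel : ∀ u x → u ℤ.* u ≡ 1ℤ → u ℤ.* (u ℤ.* x) ≡ x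
  unit-cancel u x u² =
    trans (sym (ℤ.*-assoc u u x)) (trans (cong (ℤ._* x) u²) (ℤ.*-identityˡ x))

  x-y+y : ∀ x y → (x ℤ.- y) ℤ.+ y ≡ x
  x-y+y = solve 2 (λ x y → (x :- y) :+ y := x) refl
    where open +-*-Solver

*-/-cancel : (f g : Series) {{u : IsUnit (g 0)}} → g * (f / g) ≈ f
*-/-cancel f g {{u}} zero =
  trans (ℤ.+-identityʳ _) (unit-cancel (g 0) (f 0) (unit²≡1 u))
*-/-cancel f g {{u}} (suc n) = begin
  g 0 ℤ.* (g 0 ℤ.* (f (suc n) ℤ.- s)) ℤ.+ t
    ≡⟨ cong (ℤ._+ t) (unit-cancel (g 0) _ (unit²≡1 u)) ⟩
  (f (suc n) ℤ.- s) ℤ.+ t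
    ≡⟨ cong (λ x → (f (suc n) ℤ.- s) ℤ.+ x) (sym s≡t) ⟩
  (f (suc n) ℤ.- s) ℤ.+ s
    ≡⟨ x-y+y (f (suc n)) s ⟩
  f (suc n) ∎
  where
  open ≡-Reasoning
  s t : ℤ
  s = sumℤ λ (i : Fin (suc n)) → g (suc (toℕ i)) ℤ.* lookup (quotients f g n) i
  t = sumℤ λ (i : Fin (suc n)) → g (suc (toℕ i)) ℤ.* (f / g) (n ℕ.∸ toℕ i)
  s≡t : s ≡ t
  s≡t = sum-cong-≗ ℤ.+-0-monoid λ (i : Fin (suc n)) →
    cong (g (suc (toℕ i)) ℤ.*_) (lookup-quotients f g n i)

-- (a , b) stands for a ε_2̄ + b ε_1̄.

Weight : Set
Weight = ℚ × ℚ

infixl 6 _⊕_ _⊖_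
_⊕_ _⊖_ : Weight → Weight → Weight
(a , b) ⊕ (c , d) = (a ℚ.+ c , b ℚ.+ d)
(a , b) ⊖ (c , d) = (a ℚ.- c , b ℚ.- d)

0ʷ : Weight
0ʷ = (0ℚ , 0ℚ)

infix 4 _≟ʷ_
_≟ʷ_ : DecidableEquality Weight
_≟ʷ_ = ≡-dec ℚ._≟_ ℚ._≟_

weight : ℕ → ℕ → Weight
weight m n = (ℤ.+ m ℚ./ 1 , ℤ.+ n ℚ./ 1)

record RootSystem : Set where
  field
    positiveRoots : List Weight
    ρ             : Weight

private
  2ℚ : ℚ
  2ℚ = 1ℚ ℚ.+ 1ℚ

B₂ : RootSystem
B₂ = record
  { positiveRoots = (1ℚ , 1ℚ) ∷ (1ℚ , ℚ.- 1ℚ) ∷ (0ℚ , 1ℚ) ∷ (1ℚ , 0ℚ) ∷ []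
  ; ρ             = (ℤ.+ 3 ℚ./ 2 , ½)
  }

C₂ : RootSystem
C₂ = record
  { positiveRoots = (1ℚ , 1ℚ) ∷ (1ℚ , ℚ.- 1ℚ) ∷ (0ℚ , 2ℚ) ∷ (2ℚ , 0ℚ) ∷ []
  ; ρ             = (2ℚ , 1ℚ)
  }

-- A list of pairs (a , γ) stands for the sum of the a x^γ.

FormalSum : Set
FormalSum = List (ℤ × Weight)

coeff : Weight → FormalSum → ℤ
coeff β []             = 0ℤ
coeff β ((a , γ) ∷ xs) = (if does (γ ≟ʷ β) then a else 0ℤ) ℤ.+ coeff β xs

groupRing : RawRing 0ℓ 0ℓ
groupRing = record
  { Carrier = FormalSum
  ; _≈_     = λ xs ys → ∀ β → coeff β xs ≡ coeff β ys
  ; _+_     = _++_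
  ; _*_     = cartesianProductWith λ (a , γ) (b , δ) → (a ℤ.* b , γ ⊕ δ)
  ; -_      = map λ (a , γ) → (ℤ.- a , γ)
  ; 0#      = []
  ; 1#      = (1ℤ , 0ʷ) ∷ []
  }

x^_ : Weight → FormalSum
x^ α = (1ℤ , α) ∷ []

-- The generating function is a power series in q over the group ring:
-- the coefficient of each power of q is a finite sum of terms a x^γ.

groupRing⟦q⟧ : RawRing 0ℓ 0ℓ
groupRing⟦q⟧ = PowerSeries.powerSeries groupRing

module _ where
  open RawRing groupRing⟦q⟧ using () renaming (Carrier to GSeries; _*_ to _*ᵍ_; 1# to 1ᵍ)
  open PowerSeries groupRing using (geometric)

  generatingFunction : RootSystem → GSeries
  generatingFunction Φ =
    foldr _*ᵍ_ 1ᵍ (map (λ α → geometric (x^ α)) (RootSystem.positiveRoots Φ))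

𝒫 : RootSystem → Weight → Series
𝒫 Φ β n = coeff β (generatingFunction Φ n)

private
  module G  = RawRing groupRing
  module GS = RawRing groupRing⟦q⟧
  module P  = PowerSeries groupRing
  open RawSemiringDefs G.rawSemiring using () renaming (_^_ to _^ᵍ_)
  open RawMonoidDefs G.+-rawMonoid using () renaming (sum to sumᵍ)

  multiple : ℕ → Weight → Weight
  multiple zero    α = 0ʷ
  multiple (suc n) α = α ⊕ multiple n α

  x^-power : ∀ α n → (x^ α) ^ᵍ n ≡ x^ (multiple n α)
  x^-power α zero    = refl
  x^-power α (suc n) = cong ((x^ α) G.*_) (x^-power α n)

  0ʷ-⊕ : ∀ α → 0ʷ ⊕ α ≡ α
  0ʷ-⊕ (a , b) = cong₂ _,_ (ℚ.+-identityˡ a) (ℚ.+-identityˡ b)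

  sum-[] : ∀ n → sumᵍ {n} (λ _ → []) ≡ []
  sum-[] zero    = refl
  sum-[] (suc n) = sum-[] n

  cancel : ∀ β {γ δ} → γ ≡ δ → coeff β ((1ℤ , γ) ∷ (-1ℤ , δ) ∷ []) ≡ 0ℤ
  cancel β {γ} refl with does (γ ≟ʷ β)
  ... | true  = refl
  ... | false = refl

  1-x^_q : Weight → GS.Carrier
  1-x^ α q = GS.1# GS.+ GS.- P.linear (x^ α)

  product-suc : ∀ α n → (1-x^ α q GS.* P.geometric (x^ α)) (suc n) ≡
    (1ℤ , 0ʷ ⊕ (α ⊕ multiple n α)) ∷ (-1ℤ , α ⊕ multiple n α) ∷ []
  product-suc α n rewrite sum-[] n | x^-power α n = refl

geometric-inverse : ∀ α →
  (GS.1# GS.+ GS.- P.linear (x^ α)) GS.* P.geometric (x^ α) GS.≈ GS.1#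
geometric-inverse α zero    β = refl
geometric-inverse α (suc n) β =
  trans (cong (coeff β) (product-suc α n)) (cancel β (0ʷ-⊕ (α ⊕ multiple n α)))

-- (p , s , t) first exchanges the two coordinates if p is true and then
-- multiplies them by the signs s and t.

W : Set
W = Bool × Sign × Sign

infixr 8 _·_
_·_ : Sign → ℚ → ℚ
Sign.+ · a = a
Sign.- · a = ℚ.- a

act : W → Weight → Weight
act (false , s , t) (a , b) = (s · a , t · b)
act (true  , s , t) (a , b) = (s · b , t · a)

elements : List W
elements = cartesianProduct (false ∷ true ∷ []) (cartesianProduct signs signs)
  where
  signs : List Sign
  signs = Sign.+ ∷ Sign.- ∷ []

infixl 7 _∙_
_∙_ : W → W → W
(false , s , t) ∙ (p , s′ , t′) = (p          , s Sign.* s′ , t Sign.* t′)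
(true  , s , t) ∙ (p , s′ , t′) = (true xor p , s Sign.* t′ , t Sign.* s′)

private
  ·-* : ∀ s t a → (s Sign.* t) · a ≡ s · t · a
  ·-* Sign.+ t      a = refl
  ·-* Sign.- Sign.+ a = refl
  ·-* Sign.- Sign.- a = sym (⁻¹-involutive ℚ.+-0-group a)

act-∙ : ∀ σ τ β → act (σ ∙ τ) β ≡ act σ (act τ β)
act-∙ (false , s , t) (false , s′ , t′) (a , b) = cong₂ _,_ (·-* s s′ a) (·-* t t′ b)
act-∙ (false , s , t) (true  , s′ , t′) (a , b) = cong₂ _,_ (·-* s s′ b) (·-* t t′ a)
act-∙ (true  , s , t) (false , s′ , t′) (a , b) = cong₂ _,_ (·-* s t′ b) (·-* t s′ a)
act-∙ (true  , s , t) (true  , s′ , t′) (a , b) = cong₂ _,_ (·-* s t′ a) (·-* t s′ b)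

-- s₁ and s₂ are the reflections in ε_1̄ and in ε_2̄ - ε_1̄.

data Simple : Set where
  s₁ s₂ : Simple

simple : Simple → W
simple s₁ = (false , Sign.+ , Sign.-)
simple s₂ = (true  , Sign.+ , Sign.+)

eval : List Simple → W
eval = foldr (λ s σ → simple s ∙ σ) (false , Sign.+ , Sign.+)

reducedWord : W → List Simple
reducedWord (false , Sign.+ , Sign.+) = []
reducedWord (false , Sign.+ , Sign.-) = s₁ ∷ []
reducedWord (false , Sign.- , Sign.+) = s₂ ∷ s₁ ∷ s₂ ∷ []
reducedWord (false , Sign.- , Sign.-) = s₁ ∷ s₂ ∷ s₁ ∷ s₂ ∷ []
reducedWord (true  , Sign.+ , Sign.+) = s₂ ∷ []
reducedWord (true  , Sign.+ , Sign.-) = s₁ ∷ s₂ ∷ []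
reducedWord (true  , Sign.- , Sign.+) = s₂ ∷ s₁ ∷ []
reducedWord (true  , Sign.- , Sign.-) = s₁ ∷ s₂ ∷ s₁ ∷ []

l : W → ℕ
l σ = length (reducedWord σ)

eval-reducedWord : ∀ σ → eval (reducedWord σ) ≡ σ
eval-reducedWord (false , Sign.+ , Sign.+) = refl
eval-reducedWord (false , Sign.+ , Sign.-) = refl
eval-reducedWord (false , Sign.- , Sign.+) = refl
eval-reducedWord (false , Sign.- , Sign.-) = refl
eval-reducedWord (true  , Sign.+ , Sign.+) = refl
eval-reducedWord (true  , Sign.+ , Sign.-) = refl
eval-reducedWord (true  , Sign.- , Sign.+) = refl
eval-reducedWord (true  , Sign.- , Sign.-) = refl

private
  l-step : ∀ s σ → l (simple s ∙ σ) ℕ.≤ suc (l σ)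
  l-step s₁ (false , Sign.+ , Sign.+) = toWitness {a? = _ ℕ.≤? _} _
  l-step s₁ (false , Sign.+ , Sign.-) = toWitness {a? = _ ℕ.≤? _} _
  l-step s₁ (false , Sign.- , Sign.+) = toWitness {a? = _ ℕ.≤? _} _
  l-step s₁ (false , Sign.- , Sign.-) = toWitness {a? = _ ℕ.≤? _} _
  l-step s₁ (true  , Sign.+ , Sign.+) = toWitness {a? = _ ℕ.≤? _} _
  l-step s₁ (true  , Sign.+ , Sign.-) = toWitness {a? = _ ℕ.≤? _} _
  l-step s₁ (true  , Sign.- , Sign.+) = toWitness {a? = _ ℕ.≤? _} _
  l-step s₁ (true  , Sign.- , Sign.-) = toWitness {a? = _ ℕ.≤? _} _
  l-step s₂ (false , Sign.+ , Sign.+) = toWitness {a? = _ ℕ.≤? _} _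
  l-step s₂ (false , Sign.+ , Sign.-) = toWitness {a? = _ ℕ.≤? _} _
  l-step s₂ (false , Sign.- , Sign.+) = toWitness {a? = _ ℕ.≤? _} _
  l-step s₂ (false , Sign.- , Sign.-) = toWitness {a? = _ ℕ.≤? _} _
  l-step s₂ (true  , Sign.+ , Sign.+) = toWitness {a? = _ ℕ.≤? _} _
  l-step s₂ (true  , Sign.+ , Sign.-) = toWitness {a? = _ ℕ.≤? _} _
  l-step s₂ (true  , Sign.- , Sign.+) = toWitness {a? = _ ℕ.≤? _} _
  l-step s₂ (true  , Sign.- , Sign.-) = toWitness {a? = _ ℕ.≤? _} _

l-minimal : ∀ w → l (eval w) ℕ.≤ length w
l-minimal []      = z≤n
l-minimal (s ∷ w) = ℕ.≤-trans (l-step s (eval w)) (s≤s (l-minimal w))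

-- The polynomial K_{ν,μ}(q), as a power series in q.

K : RootSystem → Weight → Weight → Series
K Φ ν μ = foldr _+_ 0# (map term elements)
  where
  open RootSystem Φ using (ρ)
  term : W → Series
  term σ = (- 1#) ^ l σ * 𝒫 Φ (act σ (ν ⊕ ρ) ⊖ (μ ⊕ ρ))

{-# OPTIONS --safe #-}

-- Put μ = 1 for B₂ and μ = 2 for C₂.  The positive roots are then (1 , 1),
-- (1 , -1), (0 , μ), (μ , 0), with ρ = (1 + μ/2 , μ/2), and only three
-- elements of W contribute to K_{λ,0}:
--   K_{(a,b),0} = 𝒫 (a , b) - 𝒫 (a , -b-μ) - 𝒫 (b-1 , a+1).
-- Splitting off the root (μ , 0) expresses the right-hand side at (a , b) as
-- q times its value at (a-μ , b) plus a difference of two values of the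
-- partition function of the other three roots; the third term drops out,
-- because without (0 , μ) every root (c , d) satisfies c ≥ d.  The
-- differences are geometric sums.  The recursion in a stops at (b-1 , b) for
-- B₂, where K vanishes by antisymmetry, and, if a - b is even, at (b-2 , b)
-- for C₂, where antisymmetry gives -K_{(b-1,b-1),0}; if a - b is odd, no term
-- lies in the root lattice of C₂.  Solving it yields K after multiplication by
-- (q - 1) (q² - 1), which can be cancelled in ℤ⟦q⟧.

module Submission where

open import Algebra.Bundles using (CommutativeRing)
open import Algebra.Bundles.Raw using (RawRing)
import Algebra.Definitions.RawMonoid as RawMonoidDefs
import Algebra.Solver.Ring as RingSolver
open import Algebra.Solver.Ring.AlmostCommutativeRing
  using (fromCommutativeRing; _-Raw-AlmostCommutative⟶_)
open import Data.Bool.Base using (true; false; if_then_else_)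
open import Data.Empty using (⊥-elim)
open import Data.Fin.Base using (Fin; zero; suc; toℕ)
open import Data.Integer.Base as ℤ using (ℤ; 0ℤ; 1ℤ; -1ℤ; +_; -[1+_]; +≤+; -<+)
  renaming (_+_ to infixl 6 _+ᶻ_; _*_ to infixl 7 _*ᶻ_; _-_ to infixl 6 _-ᶻ_; -_ to infix 8 -ᶻ_)
import Data.Integer.Divisibility.Signed as ℤ∣
import Data.Integer.Properties as ℤ
open import Data.Integer.Solver using (module +-*-Solver)
open import Data.Integer.Tactic.RingSolver using (solve-∀)
open import Data.List.Base using (List; []; _∷_; _++_; map; foldr)
import Data.List.Relation.Binary.Permutation.Propositional as ↭
open ↭ using (_↭_; prep; swap; ↭-trans)
open import Data.List.Relation.Binary.Permutation.Propositional.Properties using (shift)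
open import Data.List.Relation.Unary.All as All using (All; []; _∷_)
open import Data.Maybe.Base as Maybe using (Maybe)
open import Data.Nat as ℕ using (ℕ; zero; suc; _∸_; z≤n; s≤s)
open import Data.Nat.Divisibility
  using (_∣_; _∤_; divides; _∣?_; ∣-refl; ∣m∣n⇒∣m+n; ∣m+n∣m⇒∣n)
open import Data.Nat.DivMod using (m*n/n≡m)
import Data.Nat.Properties as ℕ
open import Data.Nat.Tactic.RingSolver using () renaming (solve-∀ to solve-∀ⁿ)
open import Data.Product using (_×_; _,_; ∃; proj₁; proj₂)
open import Data.Product.Properties using (≡-dec)
open import Data.Rational.Base as ℚ using (ℚ; 0ℚ; 1ℚ; ½; toℚᵘ)
import Data.Rational.Properties as ℚ
open import Data.Rational.Solver using () renaming (module +-*-Solver to ℚSolver)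
open ℚSolver using ()
  renaming (solve to solveʳ; _:+_ to _⊹_; _:-_ to _∸ʳ_; :-_ to ∸ʳ_; _:=_ to _≔_; con to conʳ)
open import Data.Rational.Unnormalised.Base as ℚᵘ using (mkℚᵘ; *≡*)
import Data.Rational.Unnormalised.Properties as ℚᵘ
open import Data.Sign.Base as Sign using (Sign)
open import Function.Base using (case_of_)
open import Function.Bundles using (_⇔_; mk⇔)
open import Level using (0ℓ)
open import Relation.Binary.Definitions using (DecidableEquality)
open import Relation.Binary.PropositionalEquality
  using (_≡_; refl; sym; trans; cong; cong₂; subst; module ≡-Reasoning)
import Relation.Binary.Reasoning.Setoid as SetoidReasoning
open import Relation.Nullary using (¬_; yes; no)
open import Relation.Nullary.Decidable using (dec⇒maybe; does; does-⇔)

-- The polynomial identities are stated over an abstract ring because over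
-- ℤ⟦q⟧ the type checker would unfold the convolutions in their normal forms.
module IntegerCoefficients {c ℓ} (R : CommutativeRing c ℓ)
  (homomorphism : ℤ.+-*-rawRing -Raw-AlmostCommutative⟶ fromCommutativeRing R) where

  private
    open module R = CommutativeRing R using (Carrier; _≈_; _+_; _*_; _-_; -_; 0#; 1#)
    open module H = _-Raw-AlmostCommutative⟶_ homomorphism using (⟦_⟧)
    open import Algebra.Properties.Semiring.Exp R.semiring using (_^_)

  -- The clauses for 0 and 1 let con 0ℤ and con 1ℤ denote 0# and 1#
  -- definitionally.
  embed : ℤ → Carrier
  embed (+ zero)     = 0#
  embed (+ suc zero) = 1#
  embed a            = ⟦ a ⟧

  embed≈⟦⟧ : ∀ a → embed a ≈ ⟦ a ⟧
  embed≈⟦⟧ (+ zero)        = R.sym H.0-homo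
  embed≈⟦⟧ (+ suc zero)    = R.sym H.1-homo
  embed≈⟦⟧ (+ suc (suc _)) = R.refl
  embed≈⟦⟧ ℤ.-[1+ _ ]      = R.refl

  embedding : ℤ.+-*-rawRing -Raw-AlmostCommutative⟶ fromCommutativeRing R
  embedding = record
    { ⟦_⟧    = embed
    ; +-homo = λ a b → R.trans (embed≈⟦⟧ (a +ᶻ b)) (R.trans (H.+-homo a b)
        (R.sym (R.+-cong (embed≈⟦⟧ a) (embed≈⟦⟧ b))))
    ; *-homo = λ a b → R.trans (embed≈⟦⟧ (a *ᶻ b)) (R.trans (H.*-homo a b)
        (R.sym (R.*-cong (embed≈⟦⟧ a) (embed≈⟦⟧ b))))
    ; -‿homo = λ a → R.trans (embed≈⟦⟧ (ℤ.- a)) (R.trans (H.-‿homo a)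
        (R.sym (R.-‿cong (embed≈⟦⟧ a))))
    ; 0-homo = R.refl
    ; 1-homo = R.refl
    }

  embed-≟ : ∀ a b → Maybe (embed a ≈ embed b)
  embed-≟ a b = Maybe.map (λ { refl → R.refl }) (dec⇒maybe (a ℤ.≟ b))

  module Solver = RingSolver ℤ.+-*-rawRing (fromCommutativeRing R) embedding embed-≟
  open Solver

  private
    :1 : ∀ {n} → Polynomial n
    :1 = con 1ℤ
    :denominator : ∀ {n} → Polynomial n → Polynomial n
    :denominator q = (q :- :1) :* (q :^ 2 :- :1)
    :closed : ∀ {n} (q x y z e : Polynomial n) → Polynomial n
    :closed q x y z e =
      x :* ((q :- :1) :* (q :^ 2 :* y :- e) :+ q :^ 2 :* (q :* y :- :1) :* (z :- :1))

  denominator : Carrier → Carrier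
  denominator q = (q - 1#) * (q ^ 2 - 1#)

  -- For x = q^λ₂, y = q^(2λ₁) in type B₂ and x = q^((λ₂+λ₁)/2), y = q^λ₁ in
  -- type C₂, with z = q^(λ₂-λ₁) and e = 1 or q according to parity, this is
  -- the denominator times K_{λ,0} in all the nonzero cases.
  closed : (q x y z e : Carrier) → Carrier
  closed q x y z e =
    x * ((q - 1#) * (q ^ 2 * y - e) + q ^ 2 * (q * y - 1#) * (z - 1#))

  -- The denominator times the inhomogeneous term `𝒟 1` of the recurrence, for y = q^λ₁, z =
  -- q^(λ₂-λ₁) and e = `η` (λ₂-λ₁). Here y is q^λ₁, whereas `closed` takes q^(2λ₁) in type B₂. The
  -- opposite parity value appears as 1 + q - e.
  difference₁ : (q y z e : Carrier) → Carrier
  difference₁ q y z e = (q - 1#) *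
    (y * z * ((q * (q * (y * y * z)) - e) - (q * z - (1# + q - e))))

  -- The analogue for `𝒟 2`, with y = q^λ₁ and z = q^k, where λ₂ - λ₁ = 2k.
  difference₂ : (q y z : Carrier) → Carrier
  difference₂ q y z = (q ^ 2 - 1#) * (y * (z * z) * (q * (y * z) - z))

  private
    :difference₁ : ∀ {n} (q y z e : Polynomial n) → Polynomial n
    :difference₁ q y z e = (q :- :1) :*
      (y :* z :* ((q :* (q :* (y :* y :* z)) :- e) :- (q :* z :- (:1 :+ q :- e))))
    :difference₂ : ∀ {n} (q y z : Polynomial n) → Polynomial n
    :difference₂ q y z = (q :^ 2 :- :1) :* (y :* (z :* z) :* (q :* (y :* z) :- z))

  closed-cong : ∀ q x y z {e e′} → e ≈ e′ → closed q x y z e ≈ closed q x y z e′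
  closed-cong q x y z e≈ = R.*-congˡ (R.+-congʳ (R.*-congˡ (R.+-congˡ (R.-‿cong e≈))))

  difference₁-cong : ∀ q y z {e e′} → e ≈ e′ → difference₁ q y z e ≈ difference₁ q y z e′
  difference₁-cong q y z e≈ = R.*-congˡ (R.*-congˡ (R.+-cong (R.+-congˡ (R.-‿cong e≈))
    (R.-‿cong (R.+-congˡ (R.-‿cong (R.+-congˡ (R.-‿cong e≈)))))))

  closed₁-base : ∀ q y → q * 0# + difference₁ q y 1# 1# ≈ closed q (y * 1#) (y * y) 1# 1#
  closed₁-base = solve 2 (λ q y →
    q :* con 0ℤ :+ :difference₁ q y :1 :1 := :closed q (y :* :1) (y :* y) :1 :1) R.refl

  -- Passage from λ₂ to λ₂ + 1. Both sides are affine in e and agree for every e, so one identity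
  -- serves both parities.
  closed₁-step : ∀ q y z e →
    q * closed q (y * z) (y * y) z e + difference₁ q y (q * z) (1# + q - e) ≈
    closed q (y * (q * z)) (y * y) (q * z) (1# + q - e)
  closed₁-step = solve 4 (λ q y z e →
    q :* :closed q (y :* z) (y :* y) z e :+ :difference₁ q y (q :* z) (:1 :+ q :- e) :=
    :closed q (y :* (q :* z)) (y :* y) (q :* z) (:1 :+ q :- e)) R.refl

  closed₂-base : ∀ q → q * 0# + difference₂ q 1# 1# ≈ closed q 1# 1# 1# 1#
  closed₂-base = solve 1 (λ q →
    q :* con 0ℤ :+ :difference₂ q :1 :1 := :closed q :1 :1 :1 :1) R.refl

  -- The minus sign comes from antisymmetry: one step of the recurrence leads from (b+1 , b+1) to
  -- the mirror image of (b , b). The parity of λ₁ changes, so e becomes 1 + q - e.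
  closed₂-diagonal : ∀ q y e →
    q * (- closed q y y 1# e) + difference₂ q (q * y) 1# ≈
    closed q (q * y) (q * y) 1# (1# + q - e)
  closed₂-diagonal = solve 3 (λ q y e →
    q :* (:- :closed q y y :1 e) :+ :difference₂ q (q :* y) :1 :=
    :closed q (q :* y) (q :* y) :1 (:1 :+ q :- e)) R.refl

  closed₂-unit : ∀ q y e → closed q y y 1# e ≈ closed q (y * 1#) y (1# * 1#) e
  closed₂-unit = solve 3 (λ q y e →
    :closed q y y :1 e := :closed q (y :* :1) y (:1 :* :1) e) R.refl

  closed₂-step : ∀ q y z e →
    q * closed q (y * z) y (z * z) e + difference₂ q y (q * z) ≈
    closed q (y * (q * z)) y (q * z * (q * z)) e
  closed₂-step = solve 4 (λ q y z e →
    q :* :closed q (y :* z) y (z :* z) e :+ :difference₂ q y (q :* z) :=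
    :closed q (y :* (q :* z)) y (q :* z :* (q :* z)) e) R.refl

  -- For e = q one has q²y - q = q (qy - 1), so a factor q can be taken out of the bracket.
  closed₂-odd : ∀ q x y z →
    q * x * ((q - 1#) * (q * y - 1#) + q * (q * y - 1#) * (z - 1#)) ≈ closed q x y z q
  closed₂-odd = solve 4 (λ q x y z →
    q :* x :* ((q :- :1) :* (q :* y :- :1) :+ q :* (q :* y :- :1) :* (z :- :1)) :=
    :closed q x y z q) R.refl

  -- With the factor q (qy - 1) taken out, the bracket is (q - 1) + q (z - 1) = qz - 1.
  closed₁-odd : ∀ q x y z → q * x * (q * y - 1#) * (q * z - 1#) ≈ closed q x y z q
  closed₁-odd = solve 4 (λ q x y z →
    q :* x :* (q :* y :- :1) :* (q :* z :- :1) := :closed q x y z q) R.refl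

  fractions : (s t a b c : Carrier) → Carrier
  fractions s t a b c = s * (a + t * b * c)

  -- `closed q x y z e` is by definition an instance of this with t = q ^ 2; the odd case of type C₂
  -- has t = q instead.
  cleared : (q s t f g h : Carrier) → Carrier
  cleared q s t f g h = s * ((q - 1#) * f + t * g * h)

  cleared-cong : ∀ q t {s s′ f f′ g g′ h h′} → s ≈ s′ → f ≈ f′ → g ≈ g′ → h ≈ h′ →
    cleared q s t f g h ≈ cleared q s′ t f′ g′ h′
  cleared-cong q t s≈ f≈ g≈ h≈ =
    R.*-cong s≈ (R.+-cong (R.*-congˡ f≈) (R.*-cong (R.*-congˡ g≈) h≈))

  -- The fractions a, b, c enter only through their defining equations, so that no division is
  -- required in the abstract ring.
  clear : ∀ q s t {a b c f g h} →
    (q ^ 2 - 1#) * a ≈ f → (q - 1#) * b ≈ g → (q ^ 2 - 1#) * c ≈ h →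
    denominator q * fractions s t a b c ≈ cleared q s t f g h
  clear q s t {a} {b} {c} a≈ b≈ c≈ = R.trans
    (solve 6 (λ q s t a b c → :denominator q :* (s :* (a :+ t :* b :* c)) :=
      s :* ((q :- :1) :* ((q :^ 2 :- :1) :* a) :+ t :* ((q :- :1) :* b) :* ((q :^ 2 :- :1) :* c)))
      R.refl q s t a b c)
    (cleared-cong q t R.refl a≈ b≈ c≈)

  triple : (s b c : Carrier) → Carrier
  triple s b c = s * b * c

  triple-cong : ∀ {s s′ b b′ c c′} → s ≈ s′ → b ≈ b′ → c ≈ c′ → triple s b c ≈ triple s′ b′ c′
  triple-cong s≈ b≈ c≈ = R.*-cong (R.*-cong s≈ b≈) c≈

  clear-triple : ∀ q s {b c g h} → (q - 1#) * b ≈ g → (q ^ 2 - 1#) * c ≈ h →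
    denominator q * triple s b c ≈ triple s g h
  clear-triple q s {b} {c} b≈ c≈ = R.trans
    (solve 4 (λ q s b c → :denominator q :* (s :* b :* c) :=
      s :* ((q :- :1) :* b) :* ((q :^ 2 :- :1) :* c)) R.refl q s b c)
    (triple-cong R.refl b≈ c≈)

open import Defs

-- The ring ℤ⟦q⟧

tail : Series → Series
tail f n = f (suc n)

infixr 8 _•_
_•_ : ℤ → Series → Series
(a • f) n = a *ᶻ f n

-- In degree `suc n` the convolution unfolds by definition to `f 0 *ᶻ g (suc n) +ᶻ (tail f * g) n`.
-- Most of the ring laws below follow from this by induction on the degree, with `tail f` in place
-- of f.
*-cong : ∀ {f f′ g g′} → f ≈ f′ → g ≈ g′ → f * g ≈ f′ * g′
*-cong p r zero    = cong₂ (λ x y → x *ᶻ y +ᶻ 0ℤ) (p 0) (r 0)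
*-cong p r (suc n) =
  cong₂ _+ᶻ_ (cong₂ _*ᶻ_ (p 0) (r (suc n))) (*-cong (λ i → p (suc i)) r n)

*-zeroˡ : ∀ f → 0# * f ≈ 0#
*-zeroˡ f zero    = refl
*-zeroˡ f (suc n) = trans (ℤ.+-identityˡ _) (*-zeroˡ f n)

*-identityˡ : ∀ f → 1# * f ≈ f
*-identityˡ f zero    = trans (ℤ.+-identityʳ _) (ℤ.*-identityˡ _)
*-identityˡ f (suc n) =
  trans (cong₂ _+ᶻ_ (ℤ.*-identityˡ (f (suc n))) (*-zeroˡ f n)) (ℤ.+-identityʳ _)

*-distribʳ : ∀ h f g → (f + g) * h ≈ f * h + g * h
*-distribʳ h f g zero    =
  solve 3 (λ a b c → (a :+ b) :* c :+ con 0ℤ := (a :* c :+ con 0ℤ) :+ (b :* c :+ con 0ℤ))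
    refl (f 0) (g 0) (h 0)
  where open +-*-Solver
*-distribʳ h f g (suc n) =
  trans (cong (((f 0 +ᶻ g 0) *ᶻ h (suc n)) +ᶻ_) (*-distribʳ h (tail f) (tail g) n))
    (solve 5 (λ a b c x y → (a :+ b) :* c :+ (x :+ y) := (a :* c :+ x) :+ (b :* c :+ y))
      refl (f 0) (g 0) (h (suc n)) ((tail f * h) n) ((tail g * h) n))
  where open +-*-Solver

•-*-assoc : ∀ a f g → (a • f) * g ≈ a • (f * g)
•-*-assoc a f g zero    =
  solve 3 (λ a x y → a :* x :* y :+ con 0ℤ := a :* (x :* y :+ con 0ℤ)) refl a (f 0) (g 0)
  where open +-*-Solver
•-*-assoc a f g (suc n) =
  trans (cong ((a *ᶻ f 0 *ᶻ g (suc n)) +ᶻ_) (•-*-assoc a (tail f) g n))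
    (solve 4 (λ a x y z → a :* x :* y :+ a :* z := a :* (x :* y :+ z))
      refl a (f 0) (g (suc n)) ((tail f * g) n))
  where open +-*-Solver

-- Splits off the last summand of the convolution, where the definition splits off the first.
-- Commutativity follows by comparing the two.
*-sucʳ : ∀ f g n → (f * g) (suc n) ≡ (f * tail g) n +ᶻ f (suc n) *ᶻ g 0
*-sucʳ f g zero    =
  solve 2 (λ x y → x :+ (y :+ con 0ℤ) := x :+ con 0ℤ :+ y)
    refl (f 0 *ᶻ g 1) (f 1 *ᶻ g 0)
  where open +-*-Solver
*-sucʳ f g (suc n) =
  trans (cong ((f 0 *ᶻ g (suc (suc n))) +ᶻ_) (*-sucʳ (tail f) g n))
    (sym (ℤ.+-assoc (f 0 *ᶻ g (suc (suc n))) _ _))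

*-comm : ∀ f g → f * g ≈ g * f
*-comm f g zero    = cong (ℤ._+ 0ℤ) (ℤ.*-comm (f 0) (g 0))
*-comm f g (suc n) = trans (*-sucʳ f g n)
  (trans (cong₂ _+ᶻ_ (*-comm f (tail g) n) (ℤ.*-comm (f (suc n)) (g 0)))
    (ℤ.+-comm ((tail g * f) n) _))

*-assoc : ∀ f g h → (f * g) * h ≈ f * (g * h)
*-assoc f g h zero    =
  solve 3 (λ x y z → (x :* y :+ con 0ℤ) :* z :+ con 0ℤ := x :* (y :* z :+ con 0ℤ) :+ con 0ℤ)
    refl (f 0) (g 0) (h 0)
  where open +-*-Solver
*-assoc f g h (suc n) = begin
  -- By definition the tail of f * g is `f 0 • tail g + tail f * g`.
  (f 0 *ᶻ g 0 +ᶻ 0ℤ) *ᶻ h (suc n) +ᶻ ((f 0 • tail g + tail f * g) * h) n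
    ≡⟨ cong (((f 0 *ᶻ g 0 +ᶻ 0ℤ) *ᶻ h (suc n)) +ᶻ_)
         (trans (*-distribʳ h (f 0 • tail g) (tail f * g) n)
           (cong₂ _+ᶻ_ (•-*-assoc (f 0) (tail g) h n) (*-assoc (tail f) g h n))) ⟩
  (f 0 *ᶻ g 0 +ᶻ 0ℤ) *ᶻ h (suc n) +ᶻ (f 0 *ᶻ (tail g * h) n +ᶻ (tail f * (g * h)) n)
    ≡⟨ solve 5 (λ x y z u v → (x :* y :+ con 0ℤ) :* z :+ (x :* u :+ v)
                           := x :* (y :* z :+ u) :+ v)
         refl (f 0) (g 0) (h (suc n)) ((tail g * h) n) ((tail f * (g * h)) n) ⟩
  f 0 *ᶻ (g * h) (suc n) +ᶻ (tail f * (g * h)) n ∎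
  where
  open ≡-Reasoning
  open +-*-Solver

seriesRing : CommutativeRing 0ℓ 0ℓ
seriesRing = record
  { _≈_ = _≈_ ; _+_ = _+_ ; _*_ = _*_ ; -_ = -_ ; 0# = 0# ; 1# = 1#
  ; isCommutativeRing = record
    { isRing = record
      { +-isAbelianGroup = record
        { isGroup = record
          { isMonoid = record
            { isSemigroup = record
              { isMagma = record
                { isEquivalence = record
                  { refl  = λ _ → refl
                  ; sym   = λ p n → sym (p n)
                  ; trans = λ p r n → trans (p n) (r n)
                  }
                ; ∙-cong = λ p r n → cong₂ _+ᶻ_ (p n) (r n)
                }
              ; assoc = λ f g h n → ℤ.+-assoc (f n) (g n) (h n)
              }
            ; identity = (λ f n → ℤ.+-identityˡ (f n)) , (λ f n → ℤ.+-identityʳ (f n))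
            }
          ; inverse = (λ f n → ℤ.+-inverseˡ (f n)) , (λ f n → ℤ.+-inverseʳ (f n))
          ; ⁻¹-cong = λ p n → cong ℤ.-_ (p n)
          }
        ; comm = λ f g n → ℤ.+-comm (f n) (g n)
        }
      ; *-cong     = *-cong
      ; *-assoc    = *-assoc
      ; *-identity = *-identityˡ ,
          λ f n → trans (*-comm f 1# n) (*-identityˡ f n)
      ; distrib    = (λ f g h n → trans (*-comm f (g + h) n)
            (trans (*-distribʳ f g h n) (cong₂ _+ᶻ_ (*-comm g f n) (*-comm h f n))))
          , *-distribʳ
      }
    ; *-comm = *-comm
    }
  }

open CommutativeRing seriesRing
  using (setoid; ring; semiring; *-congˡ; *-congʳ; +-cong; +-congˡ; +-congʳ; -‿cong;
         +-identityˡ; zeroʳ)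
  renaming (refl to ≈-refl; sym to ≈-sym; trans to ≈-trans; reflexive to ≈-reflexive)

constant : ℤ → Series
constant a zero    = a
constant a (suc _) = 0ℤ

constant-* : ∀ a f → constant a * f ≈ a • f
constant-* a f zero    = ℤ.+-identityʳ _
constant-* a f (suc n) =
  trans (cong ((a *ᶻ f (suc n)) +ᶻ_) (*-zeroˡ f n)) (ℤ.+-identityʳ _)

constant-homomorphism : ℤ.+-*-rawRing -Raw-AlmostCommutative⟶ fromCommutativeRing seriesRing
constant-homomorphism = record
  { ⟦_⟧    = constant
  ; +-homo = λ { a b zero → refl ; a b (suc n) → refl }
  ; *-homo = λ { a b zero → sym (constant-* a (constant b) zero)
               ; a b (suc n) → sym (trans (constant-* a (constant b) (suc n)) (ℤ.*-zeroʳ a)) }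
  ; -‿homo = λ { a zero → refl ; a (suc n) → refl }
  ; 0-homo = λ { zero → refl ; (suc n) → refl }
  ; 1-homo = λ { zero → refl ; (suc n) → refl }
  }

open IntegerCoefficients seriesRing constant-homomorphism
open Solver using (solve; _:+_; _:*_; _:-_; :-_; _:^_; _:=_; con)
open import Algebra.Properties.Ring ring using (-‿distribʳ-*)
open import Algebra.Properties.Semiring.Exp semiring using (^-homo-*)

private
  :1 : ∀ {n} → Solver.Polynomial n
  :1 = con 1ℤ

module ≈-Reasoning = SetoidReasoning setoid

*-cancelˡ : ∀ f {{_ : IsUnit (f 0)}} {g h} → f * g ≈ f * h → g ≈ h
*-cancelˡ f {g} {h} fg≈fh = begin
  g                  ≈⟨ reassociate g ⟨
  1# / f * (f * g)   ≈⟨ *-congˡ {1# / f} fg≈fh ⟩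
  1# / f * (f * h)   ≈⟨ reassociate h ⟩
  h                  ∎
  where
  open ≈-Reasoning
  reassociate : ∀ k → 1# / f * (f * k) ≈ k
  reassociate k = begin
    1# / f * (f * k)   ≈⟨ solve 3 (λ f i k → i :* (f :* k) := (f :* i) :* k) ≈-refl f (1# / f) k ⟩
    f * (1# / f) * k   ≈⟨ *-congʳ {k} (*-/-cancel 1# f) ⟩
    1# * k             ≈⟨ *-identityˡ k ⟩
    k                  ∎

q*-zero : ∀ f → (q * f) 0 ≡ 0ℤ
q*-zero f = trans (ℤ.+-identityʳ _) (ℤ.*-zeroˡ (f 0))

q*-suc : ∀ f n → (q * f) (suc n) ≡ f n
q*-suc f n = trans
  (cong₂ _+ᶻ_ (ℤ.*-zeroˡ (f (suc n)))
    (trans (*-cong tail-q (≈-refl {f}) n) (*-identityˡ f n)))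
  (ℤ.+-identityˡ (f n))
  where
  tail-q : tail q ≈ 1#
  tail-q zero    = refl
  tail-q (suc _) = refl

-- Partition functions on ℤ²

Lattice : Set
Lattice = ℤ × ℤ

infixl 6 _⊝_
_⊝_ : Lattice → Lattice → Lattice
(a , b) ⊝ (c , d) = (a -ᶻ c , b -ᶻ d)

0ˡ : Lattice
0ˡ = (0ℤ , 0ℤ)

infix 4 _≟ˡ_
_≟ˡ_ : DecidableEquality Lattice
_≟ˡ_ = ≡-dec ℤ._≟_ ℤ._≟_

⊝-comm : ∀ β α γ → β ⊝ α ⊝ γ ≡ β ⊝ γ ⊝ α
⊝-comm (a , b) (c , d) (e , f) = cong₂ _,_ (-‿comm a c e) (-‿comm b d f)
  where
  -‿comm : ∀ x y z → x -ᶻ y -ᶻ z ≡ x -ᶻ z -ᶻ y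
  -‿comm = solve-∀

-- The coefficient of x^β in the product of the 1 / (1 - q x^α), α in L; the
-- recursion multiplies it by one of the 1 - q x^α.
part : List Lattice → Lattice → Series
part []      β         = if does (β ≟ˡ 0ˡ) then 1# else 0#
part (α ∷ L) β zero    = part L β zero
part (α ∷ L) β (suc n) = part L β (suc n) +ᶻ part (α ∷ L) (β ⊝ α) n

part-∷ : ∀ α L β → part (α ∷ L) β ≈ part L β + q * part (α ∷ L) (β ⊝ α)
part-∷ α L β zero    =
  sym (trans (cong (part L β 0 +ᶻ_) (q*-zero (part (α ∷ L) (β ⊝ α)))) (ℤ.+-identityʳ _))
part-∷ α L β (suc n) =
  cong (part L β (suc n) +ᶻ_) (sym (q*-suc (part (α ∷ L) (β ⊝ α)) n))

part-prep : ∀ α {L L′} → (∀ β → part L β ≈ part L′ β) →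
            ∀ β → part (α ∷ L) β ≈ part (α ∷ L′) β
part-prep α eq β zero    = eq β zero
part-prep α eq β (suc n) = cong₂ _+ᶻ_ (eq β (suc n)) (part-prep α eq (β ⊝ α) n)

-- Expanding with respect to both vectors gives four terms on each side. The last ones count at β ⊝
-- α ⊝ γ and β ⊝ γ ⊝ α in degree n, where the induction hypothesis is used once more, backwards.
part-swap : ∀ α γ L β → part (α ∷ γ ∷ L) β ≈ part (γ ∷ α ∷ L) β
part-swap α γ L β zero          = refl
part-swap α γ L β (suc zero)    = exchange (part L β 1) (part L (β ⊝ γ) 0) (part L (β ⊝ α) 0)
  where
  exchange : ∀ x y z → x +ᶻ y +ᶻ z ≡ x +ᶻ z +ᶻ y
  exchange = solve-∀
part-swap α γ L β (suc (suc n)) = begin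
  x +ᶻ y +ᶻ part (α ∷ γ ∷ L) (β ⊝ α) (suc n)
    ≡⟨ cong (x +ᶻ y +ᶻ_) (part-swap α γ L (β ⊝ α) (suc n)) ⟩
  x +ᶻ y +ᶻ (z +ᶻ part (γ ∷ α ∷ L) (β ⊝ α ⊝ γ) n)
    ≡⟨ cong (λ u → x +ᶻ y +ᶻ (z +ᶻ u))
         (trans (sym (part-swap α γ L (β ⊝ α ⊝ γ) n))
           (cong (λ δ → part (α ∷ γ ∷ L) δ n) (⊝-comm β α γ))) ⟩
  x +ᶻ y +ᶻ (z +ᶻ w)
    ≡⟨ exchange x y z w ⟩
  x +ᶻ z +ᶻ (y +ᶻ w)
    ≡⟨ cong (x +ᶻ z +ᶻ_) (part-swap α γ L (β ⊝ γ) (suc n)) ⟩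
  x +ᶻ z +ᶻ part (γ ∷ α ∷ L) (β ⊝ γ) (suc n) ∎
  where
  open ≡-Reasoning
  x y z w : ℤ
  x = part L β (suc (suc n))
  y = part (γ ∷ L) (β ⊝ γ) (suc n)
  z = part (α ∷ L) (β ⊝ α) (suc n)
  w = part (α ∷ γ ∷ L) (β ⊝ γ ⊝ α) n
  exchange : ∀ x y z w → x +ᶻ y +ᶻ (z +ᶻ w) ≡ x +ᶻ z +ᶻ (y +ᶻ w)
  exchange = solve-∀

part-↭ : ∀ {L L′} → L ↭ L′ → ∀ β → part L β ≈ part L′ β
part-↭ ↭.refl                β = ≈-refl
part-↭ (prep α p)            β = part-prep α (part-↭ p) β
part-↭ (swap {xs} α γ p)     β =
  ≈-trans (part-swap α γ xs β) (part-prep γ (part-prep α (part-↭ p)) β)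
part-↭ (↭.trans p r)         β = ≈-trans (part-↭ p β) (part-↭ r β)

-- Subtracting vectors of L never leaves the region P, and P avoids the origin, where every
-- partition would have to end. Half-planes and a parity class will serve as P.
part-vanish : (P : Lattice → Set) → ¬ P 0ˡ →
              ∀ {L} → All (λ α → ∀ {β} → P β → P (β ⊝ α)) L → ∀ {β} → P β → part L β ≈ 0#
part-vanish P ¬P0 []             {β} Pβ n with β ≟ˡ 0ˡ
... | yes refl = ⊥-elim (¬P0 Pβ)
... | no  _    = refl
part-vanish P ¬P0 (stays ∷ all) Pβ zero    = part-vanish P ¬P0 all Pβ zero
part-vanish P ¬P0 (stays ∷ all) Pβ (suc n) =
  cong₂ _+ᶻ_ (part-vanish P ¬P0 all Pβ (suc n))
    (part-vanish P ¬P0 (stays ∷ all) (stays Pβ) n)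

record Functional : Set where
  field
    ⟨_⟩ : Lattice → ℤ
    ⟨0⟩ : ⟨ 0ˡ ⟩ ≡ 0ℤ
    ⟨⊝⟩ : ∀ β α → ⟨ β ⊝ α ⟩ ≡ ⟨ β ⟩ -ᶻ ⟨ α ⟩

open Functional

-- Subtracting vectors on which φ is nonnegative cannot raise a negative value of φ to 0.
part-negative : (φ : Functional) → ∀ {L} → All (λ α → 0ℤ ℤ.≤ ⟨ φ ⟩ α) L →
                ∀ {β} → ⟨ φ ⟩ β ℤ.< 0ℤ → part L β ≈ 0#
part-negative φ nonneg = part-vanish (λ β → ⟨ φ ⟩ β ℤ.< 0ℤ)
  (ℤ.<-irrefl (⟨0⟩ φ)) (All.map stays nonneg)
  where
  stays : ∀ {α} → 0ℤ ℤ.≤ ⟨ φ ⟩ α → ∀ {β} → ⟨ φ ⟩ β ℤ.< 0ℤ → ⟨ φ ⟩ (β ⊝ α) ℤ.< 0ℤ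
  stays {α} 0≤α {β} β<0 =
    subst (ℤ._< 0ℤ) (sym (⟨⊝⟩ φ β α)) (ℤ.+-mono-<-≤ β<0 (ℤ.neg-mono-≤ 0≤α))

first sum difference : Functional
first = record { ⟨_⟩ = proj₁ ; ⟨0⟩ = refl ; ⟨⊝⟩ = λ _ _ → refl }
sum = record
  { ⟨_⟩ = λ (a , b) → a +ᶻ b ; ⟨0⟩ = refl ; ⟨⊝⟩ = λ (a , b) (c , d) → additive a b c d }
  where
  additive : ∀ a b c d → (a -ᶻ c) +ᶻ (b -ᶻ d) ≡ (a +ᶻ b) -ᶻ (c +ᶻ d)
  additive = solve-∀
difference = record
  { ⟨_⟩ = λ (a , b) → a -ᶻ b ; ⟨0⟩ = refl ; ⟨⊝⟩ = λ (a , b) (c , d) → additive a b c d }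
  where
  additive : ∀ a b c d → (a -ᶻ c) -ᶻ (b -ᶻ d) ≡ (a -ᶻ b) -ᶻ (c -ᶻ d)
  additive = solve-∀

negative : Functional → Functional
negative φ = record
  { ⟨_⟩ = λ β → -ᶻ ⟨ φ ⟩ β
  ; ⟨0⟩ = cong -ᶻ_ (⟨0⟩ φ)
  ; ⟨⊝⟩ = λ β α → trans (cong -ᶻ_ (⟨⊝⟩ φ β α)) (ℤ.neg-distrib-+ (⟨ φ ⟩ β) (-ᶻ ⟨ φ ⟩ α))
  }

-- Comparison with 𝒫 and K

fromℤ : ℤ → ℚ
fromℤ a = a ℚ./ 1

-- The reduction to lowest terms in `ℚ._/_` blocks computation with variables; among unnormalised
-- rationals only an identity of numerators remains.
fromℤ-+ : ∀ a b → fromℤ (a +ᶻ b) ≡ fromℤ a ℚ.+ fromℤ b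
fromℤ-+ a b = ℚ.toℚᵘ-injective (begin
  toℚᵘ (fromℤ (a +ᶻ b))
    ≈⟨ ℚ.toℚᵘ-fromℚᵘ (mkℚᵘ (a +ᶻ b) 0) ⟩
  mkℚᵘ (a +ᶻ b) 0
    ≈⟨ *≡* (distrib a b) ⟩
  mkℚᵘ a 0 ℚᵘ.+ mkℚᵘ b 0
    ≈⟨ ℚᵘ.+-cong (ℚ.toℚᵘ-fromℚᵘ (mkℚᵘ a 0)) (ℚ.toℚᵘ-fromℚᵘ (mkℚᵘ b 0)) ⟨
  toℚᵘ (fromℤ a) ℚᵘ.+ toℚᵘ (fromℤ b)
    ≈⟨ ℚ.toℚᵘ-homo-+ (fromℤ a) (fromℤ b) ⟨
  toℚᵘ (fromℤ a ℚ.+ fromℤ b) ∎)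
  where
  open ℚᵘ.≃-Reasoning
  distrib : ∀ a b → (a +ᶻ b) *ᶻ 1ℤ ≡ (a *ᶻ 1ℤ +ᶻ b *ᶻ 1ℤ) *ᶻ 1ℤ
  distrib = solve-∀

fromℤ-neg : ∀ a → fromℤ (-ᶻ a) ≡ ℚ.- fromℤ a
fromℤ-neg a = ℚ.toℚᵘ-injective (begin
  toℚᵘ (fromℤ (-ᶻ a))    ≈⟨ ℚ.toℚᵘ-fromℚᵘ (mkℚᵘ (-ᶻ a) 0) ⟩
  ℚᵘ.- mkℚᵘ a 0          ≈⟨ ℚᵘ.-‿cong (ℚ.toℚᵘ-fromℚᵘ (mkℚᵘ a 0)) ⟨
  ℚᵘ.- toℚᵘ (fromℤ a)    ≈⟨ ℚ.toℚᵘ-homo‿- (fromℤ a) ⟨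
  toℚᵘ (ℚ.- fromℤ a)     ∎)
  where open ℚᵘ.≃-Reasoning

fromℤ-- : ∀ a b → fromℤ (a -ᶻ b) ≡ fromℤ a ℚ.- fromℤ b
fromℤ-- a b = trans (fromℤ-+ a (-ᶻ b)) (cong (fromℤ a ℚ.+_) (fromℤ-neg b))

fromℤ-injective : ∀ {a b} → fromℤ a ≡ fromℤ b → a ≡ b
fromℤ-injective {a} {b} eq with ℚ.fromℚᵘ-injective {x = mkℚᵘ a 0} {y = mkℚᵘ b 0} eq
... | *≡* a1≡b1 = trans (sym (ℤ.*-identityʳ a)) (trans a1≡b1 (ℤ.*-identityʳ b))

ι : Lattice → Weight
ι (a , b) = (fromℤ a , fromℤ b)

ι-⊝ : ∀ β α → ι (β ⊝ α) ≡ ι β ⊖ ι α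
ι-⊝ (a , b) (c , d) = cong₂ _,_ (fromℤ-- a c) (fromℤ-- b d)

ι-injective : ∀ {β γ} → ι β ≡ ι γ → β ≡ γ
ι-injective eq =
  cong₂ _,_ (fromℤ-injective (cong proj₁ eq)) (fromℤ-injective (cong proj₂ eq))

private
  module G  = RawRing groupRing
  module GS = RawRing groupRing⟦q⟧
open PowerSeries groupRing using (geometric)
open RawMonoidDefs G.+-rawMonoid using () renaming (sum to sumᵍ)

coeff-++ : ∀ β xs ys → coeff β (xs ++ ys) ≡ coeff β xs +ᶻ coeff β ys
coeff-++ β []             ys = sym (ℤ.+-identityˡ _)
coeff-++ β ((a , γ) ∷ xs) ys =
  trans (cong ((if does (γ ≟ʷ β) then a else 0ℤ) +ᶻ_) (coeff-++ β xs ys))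
    (sym (ℤ.+-assoc (if does (γ ≟ʷ β) then a else 0ℤ) (coeff β xs) (coeff β ys)))

monomial : ℤ × Weight → ℤ × Weight → ℤ × Weight
monomial (a , γ) (b , δ) = (a *ᶻ b , γ ⊕ δ)

-- An equivalence, so that `does-⇔` can identify the Boolean tests by which `coeff` selects terms at
-- β and at β ⊖ α.
⊖-transpose : ∀ β α γ δ → ((α ⊕ γ) ⊕ δ ≡ β) ⇔ (γ ⊕ δ ≡ β ⊖ α)
⊖-transpose (b , b′) (a , a′) (c , c′) (d , d′) = mk⇔
  (λ { refl → cong₂ _,_ (to a c d) (to a′ c′ d′) })
  (λ eq → cong₂ _,_ (from a b c d (cong proj₁ eq)) (from a′ b′ c′ d′ (cong proj₂ eq)))
  where
  to : ∀ a c d → c ℚ.+ d ≡ a ℚ.+ c ℚ.+ d ℚ.- a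
  to = solveʳ 3 (λ a c d → c ⊹ d ≔ a ⊹ c ⊹ d ∸ʳ a) refl
  from : ∀ a b c d → c ℚ.+ d ≡ b ℚ.- a → a ℚ.+ c ℚ.+ d ≡ b
  from a b c d eq = trans (ℚ.+-assoc a c d) (trans (cong (a ℚ.+_) eq)
    (solveʳ 2 (λ a b → a ⊹ (b ∸ʳ a) ≔ b) refl a b))

coeff-x^-monomial : ∀ β α a γ xs →
  coeff β (map (monomial (1ℤ *ᶻ a , α ⊕ γ)) xs) ≡ coeff (β ⊖ α) (map (monomial (a , γ)) xs)
coeff-x^-monomial β α a γ []             = refl
coeff-x^-monomial β α a γ ((b , δ) ∷ xs) = cong₂ _+ᶻ_
  (cong₂ (λ t u → if t then u else 0ℤ)
    (does-⇔ (⊖-transpose β α γ δ) ((α ⊕ γ) ⊕ δ ≟ʷ β) (γ ⊕ δ ≟ʷ β ⊖ α))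
    (cong (_*ᶻ b) (ℤ.*-identityˡ a)))
  (coeff-x^-monomial β α a γ xs)

-- Multiplication by x^α translates coefficients. The bracketing is the one that appears when the
-- power in `geometric (x^ α) (suc i)` unfolds inside a convolution.
coeff-x^-* : ∀ β α xs ys → coeff β (((x^ α) G.* xs) G.* ys) ≡ coeff (β ⊖ α) (xs G.* ys)
coeff-x^-* β α []             ys = refl
coeff-x^-* β α ((a , γ) ∷ xs) ys = begin
  coeff β (map (monomial (1ℤ *ᶻ a , α ⊕ γ)) ys ++ ((x^ α) G.* xs) G.* ys)
    ≡⟨ coeff-++ β (map (monomial (1ℤ *ᶻ a , α ⊕ γ)) ys) _ ⟩
  coeff β (map (monomial (1ℤ *ᶻ a , α ⊕ γ)) ys) +ᶻ coeff β (((x^ α) G.* xs) G.* ys)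
    ≡⟨ cong₂ _+ᶻ_ (coeff-x^-monomial β α a γ ys) (coeff-x^-* β α xs ys) ⟩
  coeff (β ⊖ α) (map (monomial (a , γ)) ys) +ᶻ coeff (β ⊖ α) (xs G.* ys)
    ≡⟨ coeff-++ (β ⊖ α) (map (monomial (a , γ)) ys) _ ⟨
  coeff (β ⊖ α) (map (monomial (a , γ)) ys ++ xs G.* ys) ∎
  where open ≡-Reasoning

coeff-1-* : ∀ β xs → coeff β (G.1# G.* xs) ≡ coeff β xs
coeff-1-* β []             = refl
coeff-1-* β ((b , (d , d′)) ∷ xs) = cong₂ _+ᶻ_
  (cong₂ (λ b δ → if does (δ ≟ʷ β) then b else 0ℤ) (ℤ.*-identityˡ b)
    (cong₂ _,_ (ℚ.+-identityˡ d) (ℚ.+-identityˡ d′)))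
  (coeff-1-* β xs)

coeff-sum : ∀ β γ {n} (f g : Fin n → FormalSum) → (∀ i → coeff β (f i) ≡ coeff γ (g i)) →
            coeff β (sumᵍ f) ≡ coeff γ (sumᵍ g)
coeff-sum β γ {zero}  f g eq = refl
coeff-sum β γ {suc n} f g eq = trans (coeff-++ β (f zero) _)
  (trans (cong₂ _+ᶻ_ (eq zero)
      (coeff-sum β γ (λ i → f (suc i)) (λ i → g (suc i)) (λ i → eq (suc i))))
    (sym (coeff-++ γ (g zero) _)))

-- The coefficients of H = F + q x^α H for H = F / (1 - q x^α). This is the recursion that defines
-- `part`.
coeff-geometric-* : ∀ β α F n → coeff β ((geometric (x^ α) GS.* F) (suc n)) ≡
  coeff β (F (suc n)) +ᶻ coeff (β ⊖ α) ((geometric (x^ α) GS.* F) n)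
coeff-geometric-* β α F n = trans
  (coeff-++ β (G.1# G.* F (suc n)) _)
  (cong₂ _+ᶻ_ (coeff-1-* β (F (suc n)))
    (coeff-sum β (β ⊖ α) {suc n}
      (λ i → geometric (x^ α) (suc (toℕ i)) G.* F (n ∸ toℕ i))
      (λ i → geometric (x^ α) (toℕ i) G.* F (n ∸ toℕ i))
      (λ i → coeff-x^-* β α (geometric (x^ α) (toℕ i)) (F (n ∸ toℕ i)))))

∏geometric : List Lattice → GS.Carrier
∏geometric L = foldr GS._*_ GS.1# (map (λ α → geometric (x^ α)) (map ι L))

coeff-∏geometric : ∀ L β n → coeff (ι β) (∏geometric L n) ≡ part L β n
coeff-∏geometric [] β zero = trans (ℤ.+-identityʳ _)
  (trans (cong (if_then 1ℤ else 0ℤ)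
      (does-⇔ (mk⇔ (λ eq → ι-injective (sym eq)) (λ eq → cong ι (sym eq)))
        (0ʷ ≟ʷ ι β) (β ≟ˡ 0ˡ)))
    (branch (does (β ≟ˡ 0ˡ))))
  where
  branch : ∀ t → (if t then 1ℤ else 0ℤ) ≡ (if t then 1# else 0#) 0
  branch true  = refl
  branch false = refl
coeff-∏geometric [] β (suc n) with does (β ≟ˡ 0ˡ)
... | true  = refl
... | false = refl
coeff-∏geometric (α ∷ L) β zero = trans (coeff-++ (ι β) (G.1# G.* ∏geometric L 0) [])
  (trans (ℤ.+-identityʳ _) (trans (coeff-1-* (ι β) (∏geometric L 0)) (coeff-∏geometric L β zero)))
coeff-∏geometric (α ∷ L) β (suc n) = trans
  (coeff-geometric-* (ι β) (ι α) (∏geometric L) n)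
  (cong₂ _+ᶻ_ (coeff-∏geometric L β (suc n))
    (trans (cong (λ γ → coeff γ (∏geometric (α ∷ L) n)) (sym (ι-⊝ β α)))
      (coeff-∏geometric (α ∷ L) (β ⊝ α) n)))

roots : ℕ → List Lattice
roots μ = (1ℤ , 1ℤ) ∷ (1ℤ , -1ℤ) ∷ (0ℤ , + μ) ∷ (+ μ , 0ℤ) ∷ []

0≤ : ∀ {n} → 0ℤ ℤ.≤ + n
0≤ = +≤+ z≤n

-- Defined on all of ℤ², because the recurrence leaves the dominant chamber before it stops.
𝒦 : ℕ → Lattice → Series
𝒦 μ (a , b) =
  part (roots μ) (a , b) - part (roots μ) (a , -ᶻ b -ᶻ + μ) - part (roots μ) (b -ᶻ 1ℤ , a +ᶻ 1ℤ)

neg-pos<0 : ∀ m n → -ᶻ + m -ᶻ + suc n ℤ.< 0ℤ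
neg-pos<0 zero    n = -<+
neg-pos<0 (suc m) n = -<+

module _ (Φ : RootSystem) (μ : ℕ) (h : ℚ)
         (roots≡ : RootSystem.positiveRoots Φ ≡ map ι (roots μ))
         (ρ≡ : RootSystem.ρ Φ ≡ (1ℚ ℚ.+ h , h)) (h+h≡μ : h ℚ.+ h ≡ fromℤ (+ μ)) where
  𝒫≈part : ∀ {γ} β → γ ≡ ι β → 𝒫 Φ γ ≈ part (roots μ) β
  𝒫≈part β refl n rewrite roots≡ = coeff-∏geometric (roots μ) β n

  private
    s : ℚ
    s = 1ℚ ℚ.+ h

  x+s-s : ∀ x → fromℤ x ℚ.+ s ℚ.- (0ℚ ℚ.+ s) ≡ fromℤ x
  x+s-s x = solveʳ 2 (λ x s → x ⊹ s ∸ʳ (conʳ 0ℚ ⊹ s) ≔ x) refl (fromℤ x) s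
  x+h-h : ∀ x → fromℤ x ℚ.+ h ℚ.- (0ℚ ℚ.+ h) ≡ fromℤ x
  x+h-h x = solveʳ 2 (λ x s → x ⊹ s ∸ʳ (conʳ 0ℚ ⊹ s) ≔ x) refl (fromℤ x) h
  x+h-s : ∀ x → fromℤ x ℚ.+ h ℚ.- (0ℚ ℚ.+ s) ≡ fromℤ (x -ᶻ 1ℤ)
  x+h-s x = trans
    (solveʳ 2 (λ x h → x ⊹ h ∸ʳ (conʳ 0ℚ ⊹ (conʳ 1ℚ ⊹ h)) ≔ x ∸ʳ conʳ 1ℚ) refl (fromℤ x) h)
    (sym (fromℤ-- x 1ℤ))
  x+s-h : ∀ x → fromℤ x ℚ.+ s ℚ.- (0ℚ ℚ.+ h) ≡ fromℤ (x +ᶻ 1ℤ)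
  x+s-h x = trans
    (solveʳ 2 (λ x h → x ⊹ (conʳ 1ℚ ⊹ h) ∸ʳ (conʳ 0ℚ ⊹ h) ≔ x ⊹ conʳ 1ℚ) refl (fromℤ x) h)
    (sym (fromℤ-+ x 1ℤ))
  -x-r-r′ : ∀ x k r r′ → r ℚ.+ r′ ≡ fromℤ k →
    ℚ.- (fromℤ x ℚ.+ r) ℚ.- (0ℚ ℚ.+ r′) ≡ fromℤ (-ᶻ x -ᶻ k)
  -x-r-r′ x k r r′ eq = trans
    (solveʳ 3 (λ x r r′ → ∸ʳ (x ⊹ r) ∸ʳ (conʳ 0ℚ ⊹ r′) ≔ ∸ʳ x ∸ʳ (r ⊹ r′)) refl (fromℤ x) r r′)
    (trans (cong₂ ℚ._-_ (sym (fromℤ-neg x)) eq) (sym (fromℤ-- (-ᶻ x) k)))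

  s+s : s ℚ.+ s ≡ fromℤ (+ suc (suc μ))
  s+s = trans
    (solveʳ 1 (λ h → (conʳ 1ℚ ⊹ h) ⊹ (conʳ 1ℚ ⊹ h) ≔ conʳ (1ℚ ℚ.+ 1ℚ) ⊹ (h ⊹ h)) refl h)
    (trans (cong ((1ℚ ℚ.+ 1ℚ) ℚ.+_) h+h≡μ) (sym (fromℤ-+ (+ 2) (+ μ))))
  s+h : s ℚ.+ h ≡ fromℤ (+ suc μ)
  s+h = trans (ℚ.+-assoc 1ℚ h h)
    (trans (cong (1ℚ ℚ.+_) h+h≡μ) (sym (fromℤ-+ (+ 1) (+ μ))))
  h+s : h ℚ.+ s ≡ fromℤ (+ suc μ)
  h+s = trans (ℚ.+-comm h s) s+h

  -- Five of the eight terms vanish: in four of them the first coordinate is negative, and in the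
  -- sixth the sum of the coordinates is, whereas all positive roots are nonnegative there.
  K≈𝒦 : ∀ b n → K Φ (weight (b ℕ.+ n) b) 0ʷ ≈ 𝒦 μ (+ (b ℕ.+ n) , + b)
  K≈𝒦 b n rewrite ρ≡ = begin
    -- The exponents are the lengths of the Weyl group elements in the order of `elements`.
    (- 1#) ^ 0 * 𝒫 Φ γ₁ + ((- 1#) ^ 1 * 𝒫 Φ γ₂ +
      ((- 1#) ^ 3 * 𝒫 Φ γ₃ + ((- 1#) ^ 4 * 𝒫 Φ γ₄ +
      ((- 1#) ^ 1 * 𝒫 Φ γ₅ + ((- 1#) ^ 2 * 𝒫 Φ γ₆ +
      ((- 1#) ^ 2 * 𝒫 Φ γ₇ + ((- 1#) ^ 3 * 𝒫 Φ γ₈ + 0#)))))))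
      ≈⟨ term 0 e₁ (term 1 e₂ (term 3 e₃ (term 4 e₄
           (term 1 e₅ (term 2 e₆ (term 2 e₇ (term 3 e₈ ≈-refl))))))) ⟩
    (- 1#) ^ 0 * p₁ + ((- 1#) ^ 1 * p₂ + ((- 1#) ^ 3 * 0# + ((- 1#) ^ 4 * 0# +
      ((- 1#) ^ 1 * p₃ + ((- 1#) ^ 2 * 0# + ((- 1#) ^ 2 * 0# + ((- 1#) ^ 3 * 0# + 0#)))))))
      ≈⟨ solve 3 (λ x y z → let m = :- :1; o = con 0ℤ in
           m :^ 0 :* x :+ (m :^ 1 :* y :+ (m :^ 3 :* o :+ (m :^ 4 :* o :+
             (m :^ 1 :* z :+ (m :^ 2 :* o :+ (m :^ 2 :* o :+ (m :^ 3 :* o :+ o)))))))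
           := x :- y :- z) ≈-refl p₁ p₂ p₃ ⟩
    p₁ - p₂ - p₃ ∎
    where
    open ≈-Reasoning
    a : ℕ
    a = b ℕ.+ n
    γ₁ γ₂ γ₃ γ₄ γ₅ γ₆ γ₇ γ₈ ν′ ρ′ : Weight
    ν′ = weight a b ⊕ (s , h)
    ρ′ = 0ʷ ⊕ (s , h)
    γ₁ = act (false , Sign.+ , Sign.+) ν′ ⊖ ρ′
    γ₂ = act (false , Sign.+ , Sign.-) ν′ ⊖ ρ′
    γ₃ = act (false , Sign.- , Sign.+) ν′ ⊖ ρ′
    γ₄ = act (false , Sign.- , Sign.-) ν′ ⊖ ρ′
    γ₅ = act (true , Sign.+ , Sign.+) ν′ ⊖ ρ′
    γ₆ = act (true , Sign.+ , Sign.-) ν′ ⊖ ρ′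
    γ₇ = act (true , Sign.- , Sign.+) ν′ ⊖ ρ′
    γ₈ = act (true , Sign.- , Sign.-) ν′ ⊖ ρ′
    p₁ p₂ p₃ : Series
    p₁ = part (roots μ) (+ a , + b)
    p₂ = part (roots μ) (+ a , -ᶻ + b -ᶻ + μ)
    p₃ = part (roots μ) (+ b -ᶻ 1ℤ , + a +ᶻ 1ℤ)
    term : ∀ k {f g f′ g′} → f ≈ g → f′ ≈ g′ → (- 1#) ^ k * f + f′ ≈ (- 1#) ^ k * g + g′
    term k {f} {g} f≈g f′≈g′ = +-cong (*-congˡ {(- 1#) ^ k} f≈g) f′≈g′
    -a-2-μ -a-1-μ -b-1-μ -b-μ : ℤ
    -a-2-μ = -ᶻ + a -ᶻ + suc (suc μ)
    -a-1-μ = -ᶻ + a -ᶻ + suc μ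
    -b-1-μ = -ᶻ + b -ᶻ + suc μ
    -b-μ   = -ᶻ + b -ᶻ + μ
    e₁ : 𝒫 Φ γ₁ ≈ p₁
    e₁ = 𝒫≈part (+ a , + b) (cong₂ _,_ (x+s-s (+ a)) (x+h-h (+ b)))
    e₂ : 𝒫 Φ γ₂ ≈ p₂
    e₂ = 𝒫≈part (+ a , -b-μ) (cong₂ _,_ (x+s-s (+ a)) (-x-r-r′ (+ b) (+ μ) h h h+h≡μ))
    e₅ : 𝒫 Φ γ₅ ≈ p₃
    e₅ = 𝒫≈part (+ b -ᶻ 1ℤ , + a +ᶻ 1ℤ) (cong₂ _,_ (x+h-s (+ b)) (x+s-h (+ a)))
    first-negative : ∀ x y → x ℤ.< 0ℤ → part (roots μ) (x , y) ≈ 0#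
    first-negative x y = part-negative first (0≤ ∷ 0≤ ∷ 0≤ ∷ 0≤ ∷ []) {x , y}
    e₃ : 𝒫 Φ γ₃ ≈ 0#
    e₃ = ≈-trans
      (𝒫≈part (-a-2-μ , + b)
        (cong₂ _,_ (-x-r-r′ (+ a) (+ suc (suc μ)) s s s+s) (x+h-h (+ b))))
      (first-negative -a-2-μ (+ b) (neg-pos<0 a (suc μ)))
    e₄ : 𝒫 Φ γ₄ ≈ 0#
    e₄ = ≈-trans
      (𝒫≈part (-a-2-μ , -b-μ)
        (cong₂ _,_ (-x-r-r′ (+ a) (+ suc (suc μ)) s s s+s) (-x-r-r′ (+ b) (+ μ) h h h+h≡μ)))
      (first-negative -a-2-μ -b-μ (neg-pos<0 a (suc μ)))
    -- Dominance enters here: with λ₂ = b + n the sum of the coordinates is -(n + 2 + μ).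
    e₆ : 𝒫 Φ γ₆ ≈ 0#
    e₆ = ≈-trans
      (𝒫≈part (+ b -ᶻ 1ℤ , -a-1-μ) (cong₂ _,_ (x+h-s (+ b)) (-x-r-r′ (+ a) (+ suc μ) s h s+h)))
      (part-negative sum (0≤ ∷ 0≤ ∷ 0≤ ∷ 0≤ ∷ []) {+ b -ᶻ 1ℤ , -a-1-μ}
        (subst (ℤ._< 0ℤ) (sym (rearrange (+ b) (+ n) (+ μ))) (neg-pos<0 n (suc μ))))
      where
      rearrange : ∀ b n μ → b -ᶻ 1ℤ +ᶻ (-ᶻ (b +ᶻ n) -ᶻ (1ℤ +ᶻ μ)) ≡ -ᶻ n -ᶻ (1ℤ +ᶻ (1ℤ +ᶻ μ))
      rearrange = solve-∀
    e₇ : 𝒫 Φ γ₇ ≈ 0#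
    e₇ = ≈-trans
      (𝒫≈part (-b-1-μ , + a +ᶻ 1ℤ) (cong₂ _,_ (-x-r-r′ (+ b) (+ suc μ) h s h+s) (x+s-h (+ a))))
      (first-negative -b-1-μ (+ a +ᶻ 1ℤ) (neg-pos<0 b μ))
    e₈ : 𝒫 Φ γ₈ ≈ 0#
    e₈ = ≈-trans
      (𝒫≈part (-b-1-μ , -a-1-μ)
        (cong₂ _,_ (-x-r-r′ (+ b) (+ suc μ) h s h+s) (-x-r-r′ (+ a) (+ suc μ) s h s+h)))
      (first-negative -b-1-μ -a-1-μ (neg-pos<0 b μ))

K-B₂ : ∀ b n → K B₂ (weight (b ℕ.+ n) b) 0ʷ ≈ 𝒦 1 (+ (b ℕ.+ n) , + b)
K-B₂ = K≈𝒦 B₂ 1 ½ refl refl refl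

K-C₂ : ∀ b n → K C₂ (weight (b ℕ.+ n) b) 0ʷ ≈ 𝒦 2 (+ (b ℕ.+ n) , + b)
K-C₂ = K≈𝒦 C₂ 2 1ℚ refl refl refl

-- Closed forms

part-cong : ∀ L {a b c d} → a ≡ c → b ≡ d → part L (a , b) ≈ part L (c , d)
part-cong L refl refl = ≈-refl

≡neg⇒<0 : ∀ {x} n → x ≡ -ᶻ + suc n → x ℤ.< 0ℤ
≡neg⇒<0 n refl = -<+

antidiagonal diagonals : List Lattice
antidiagonal = (1ℤ , -1ℤ) ∷ []
diagonals    = (1ℤ , 1ℤ) ∷ antidiagonal

part-antidiagonal : ∀ a → part antidiagonal (+ a , -ᶻ + a) ≈ q ^ a
part-antidiagonal zero    = begin
  part antidiagonal (0ℤ , 0ℤ)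
    ≈⟨ part-∷ (1ℤ , -1ℤ) [] (0ℤ , 0ℤ) ⟩
  1# + q * part antidiagonal (-1ℤ , 1ℤ)
    ≈⟨ +-congˡ {1#} (*-congˡ {q} (part-negative first (0≤ ∷ []) { -1ℤ , 1ℤ} -<+)) ⟩
  1# + q * 0#
    ≈⟨ solve 1 (λ q → :1 :+ q :* con 0ℤ := :1) ≈-refl q ⟩
  1# ∎
  where open ≈-Reasoning
part-antidiagonal (suc a) = begin
  part antidiagonal (+ suc a , -ᶻ + suc a)
    ≈⟨ part-∷ (1ℤ , -1ℤ) [] (+ suc a , -ᶻ + suc a) ⟩
  0# + q * part antidiagonal (+ suc a -ᶻ 1ℤ , -ᶻ + suc a -ᶻ -1ℤ)
    ≈⟨ +-identityˡ (q * part antidiagonal (+ suc a -ᶻ 1ℤ , -ᶻ + suc a -ᶻ -1ℤ)) ⟩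
  q * part antidiagonal (+ suc a -ᶻ 1ℤ , -ᶻ + suc a -ᶻ -1ℤ)
    ≈⟨ *-congˡ {q} (part-cong antidiagonal (e₁ (+ a)) (e₂ (+ a))) ⟩
  q * part antidiagonal (+ a , -ᶻ + a)
    ≈⟨ *-congˡ {q} (part-antidiagonal a) ⟩
  q * q ^ a ∎
  where
  open ≈-Reasoning
  e₁ : ∀ a → 1ℤ +ᶻ a -ᶻ 1ℤ ≡ a
  e₁ = solve-∀
  e₂ : ∀ a → -ᶻ (1ℤ +ᶻ a) -ᶻ -1ℤ ≡ -ᶻ a
  e₂ = solve-∀

part-antidiagonal-above : ∀ a j → part antidiagonal (+ a , -ᶻ + a +ᶻ + suc j) ≈ 0#
part-antidiagonal-above a j =
  part-negative (negative sum) (0≤ ∷ []) {+ a , -ᶻ + a +ᶻ + suc j}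
    (≡neg⇒<0 j (e (+ a) (+ suc j)))
  where
  e : ∀ a j → -ᶻ (a +ᶻ (-ᶻ a +ᶻ j)) ≡ -ᶻ j
  e = solve-∀

even : ℕ → Series
even zero          = 1#
even (suc zero)    = 0#
even (suc (suc n)) = even n

-- Writing the point as c (1 , 1) + d (1 , -1) forces c + d = a and 2c = j, where j is the sum of
-- its coordinates. So there is one solution, of degree a, if j is even and none otherwise; j ≤ 2a
-- ensures d ≥ 0.
part-diagonals : ∀ a j → j ℕ.≤ a ℕ.+ a → part diagonals (+ a , -ᶻ + a +ᶻ + j) ≈ even j * q ^ a
part-diagonals a zero _ = begin
  part diagonals (+ a , -ᶻ + a +ᶻ 0ℤ)
    ≈⟨ part-∷ (1ℤ , 1ℤ) antidiagonal (+ a , -ᶻ + a +ᶻ 0ℤ) ⟩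
  part antidiagonal (+ a , -ᶻ + a +ᶻ 0ℤ) + q * part diagonals (+ a -ᶻ 1ℤ , -ᶻ + a +ᶻ 0ℤ -ᶻ 1ℤ)
    ≈⟨ +-cong (≈-trans
           (part-cong antidiagonal refl (ℤ.+-identityʳ (-ᶻ + a))) (part-antidiagonal a))
         (*-congˡ {q} (part-negative sum (0≤ ∷ 0≤ ∷ []) {+ a -ᶻ 1ℤ , -ᶻ + a +ᶻ 0ℤ -ᶻ 1ℤ}
           (≡neg⇒<0 1 (e (+ a))))) ⟩
  q ^ a + q * 0#
    ≈⟨ solve 2 (λ q x → x :+ q :* con 0ℤ := :1 :* x) ≈-refl q (q ^ a) ⟩
  1# * q ^ a ∎
  where
  open ≈-Reasoning
  e : ∀ a → a -ᶻ 1ℤ +ᶻ (-ᶻ a +ᶻ 0ℤ -ᶻ 1ℤ) ≡ -ᶻ + 2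
  e = solve-∀
part-diagonals a (suc zero) _ = begin
  part diagonals (+ a , -ᶻ + a +ᶻ 1ℤ)
    ≈⟨ part-∷ (1ℤ , 1ℤ) antidiagonal (+ a , -ᶻ + a +ᶻ 1ℤ) ⟩
  part antidiagonal (+ a , -ᶻ + a +ᶻ 1ℤ) + q * part diagonals (+ a -ᶻ 1ℤ , -ᶻ + a +ᶻ 1ℤ -ᶻ 1ℤ)
    ≈⟨ +-cong (part-antidiagonal-above a 0)
         (*-congˡ {q} (part-negative sum (0≤ ∷ 0≤ ∷ []) {+ a -ᶻ 1ℤ , -ᶻ + a +ᶻ 1ℤ -ᶻ 1ℤ}
           (≡neg⇒<0 0 (e (+ a))))) ⟩
  0# + q * 0#
    ≈⟨ solve 2 (λ q x → con 0ℤ :+ q :* con 0ℤ := con 0ℤ :* x) ≈-refl q (q ^ a) ⟩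
  0# * q ^ a ∎
  where
  open ≈-Reasoning
  e : ∀ a → a -ᶻ 1ℤ +ᶻ (-ᶻ a +ᶻ 1ℤ -ᶻ 1ℤ) ≡ -ᶻ + 1
  e = solve-∀
part-diagonals (suc a) (suc (suc j)) (s≤s j≤) = begin
  part diagonals (+ suc a , -ᶻ + suc a +ᶻ + suc (suc j))
    ≈⟨ part-∷ (1ℤ , 1ℤ) antidiagonal (+ suc a , -ᶻ + suc a +ᶻ + suc (suc j)) ⟩
  part antidiagonal (+ suc a , -ᶻ + suc a +ᶻ + suc (suc j)) +
    q * part diagonals (+ suc a -ᶻ 1ℤ , -ᶻ + suc a +ᶻ + suc (suc j) -ᶻ 1ℤ)
    ≈⟨ +-cong (part-antidiagonal-above (suc a) (suc j))
         (*-congˡ {q} (≈-trans (part-cong diagonals (e₁ (+ a)) (e₂ (+ a) (+ j)))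
           (part-diagonals a j (ℕ.s≤s⁻¹ (subst (suc j ℕ.≤_) (ℕ.+-suc a a) j≤))))) ⟩
  0# + q * (even j * q ^ a)
    ≈⟨ solve 3 (λ q x y → con 0ℤ :+ q :* (x :* y) := x :* (q :* y)) ≈-refl q (even j) (q ^ a) ⟩
  even j * (q * q ^ a) ∎
  where
  open ≈-Reasoning
  e₁ : ∀ a → 1ℤ +ᶻ a -ᶻ 1ℤ ≡ a
  e₁ = solve-∀
  e₂ : ∀ a j → -ᶻ (1ℤ +ᶻ a) +ᶻ (+ 2 +ᶻ j) -ᶻ 1ℤ ≡ -ᶻ a +ᶻ j
  e₂ = solve-∀

-- Supplies the parity parameter e of `closed`.
η : ℕ → Series
η zero          = 1#
η (suc zero)    = q
η (suc (suc n)) = η n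

-- Expresses the alternation of 1 and q by a ring operation, so that the polynomial identities avoid
-- a case distinction on parity.
η-suc : ∀ n → η (suc n) ≈ 1# + q - η n
η-suc zero          = solve 1 (λ q → q := :1 :+ q :- :1) ≈-refl q
η-suc (suc zero)    = solve 1 (λ q → :1 := :1 :+ q :- q) ≈-refl q
η-suc (suc (suc n)) = η-suc n

-- A telescoping form of the parity indicator: multiplied by q² - 1, its sum against powers of q
-- collapses.
even-η : ∀ n → (q ^ 2 - 1#) * even n ≈ q * η (suc n) - η n
even-η zero          = solve 1 (λ q → (q :^ 2 :- :1) :* :1 := q :* q :- :1) ≈-refl q
even-η (suc zero)    = solve 1 (λ q → (q :^ 2 :- :1) :* con 0ℤ := q :* :1 :- q) ≈-refl q
even-η (suc (suc n)) = even-η n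

even-n+n : ∀ n → even (n ℕ.+ n) ≡ 1#
even-n+n zero    = refl
even-n+n (suc n) = trans (cong even (cong suc (ℕ.+-suc n n))) (even-n+n n)

η-n+n+ : ∀ n m → η (n ℕ.+ n ℕ.+ m) ≡ η m
η-n+n+ zero    m = refl
η-n+n+ (suc n) m = trans (cong (λ k → η (suc (k ℕ.+ m))) (ℕ.+-suc n n)) (η-n+n+ n m)

-- The positive roots other than (μ , 0), which is the one split off in the recurrence.
vertical : ℕ → List Lattice
vertical μ = (0ℤ , + μ) ∷ diagonals

-- A geometric sum of ratio q²: after k copies of (0 , 1) the coordinates add up to j - 1 - k, and
-- the diagonal roots contribute q^a if this is even and nonnegative. The offset by one lets the
-- induction start at coordinate sum -1, where there are no partitions.
part-vertical₁ : ∀ a j → j ℕ.≤ suc (a ℕ.+ a) →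
  (q ^ 2 - 1#) * part (vertical 1) (+ a , -ᶻ + a -ᶻ 1ℤ +ᶻ + j) ≈ q ^ a * (q ^ suc j - η (suc j))
part-vertical₁ a zero _ = begin
  (q ^ 2 - 1#) * part (vertical 1) (+ a , -ᶻ + a -ᶻ 1ℤ +ᶻ 0ℤ)
    ≈⟨ *-congˡ {q ^ 2 - 1#} (part-negative sum (0≤ ∷ 0≤ ∷ 0≤ ∷ [])
         {+ a , -ᶻ + a -ᶻ 1ℤ +ᶻ 0ℤ} (≡neg⇒<0 0 (e (+ a)))) ⟩
  (q ^ 2 - 1#) * 0#
    ≈⟨ solve 2 (λ q x → (q :^ 2 :- :1) :* con 0ℤ := x :* (q :^ 1 :- q)) ≈-refl q (q ^ a) ⟩
  q ^ a * (q ^ 1 - q) ∎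
  where
  open ≈-Reasoning
  e : ∀ a → a +ᶻ (-ᶻ a -ᶻ 1ℤ +ᶻ 0ℤ) ≡ -ᶻ + 1
  e = solve-∀
part-vertical₁ a (suc j) (s≤s j≤) = begin
  (q ^ 2 - 1#) * part (vertical 1) (+ a , x)
    ≈⟨ *-congˡ {q ^ 2 - 1#} (part-∷ (0ℤ , 1ℤ) diagonals (+ a , x)) ⟩
  (q ^ 2 - 1#) * (part diagonals (+ a , x) + q * part (vertical 1) (+ a -ᶻ 0ℤ , x -ᶻ 1ℤ))
    ≈⟨ *-congˡ {q ^ 2 - 1#} (+-cong
         (≈-trans (part-cong diagonals refl (e₁ (+ a) (+ j))) (part-diagonals a j j≤))
         (*-congˡ {q} (part-cong (vertical 1) (ℤ.+-identityʳ (+ a)) (e₂ (+ a) (+ j))))) ⟩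
  (q ^ 2 - 1#) * (even j * q ^ a + q * p)
    ≈⟨ solve 4 (λ q r s p → (q :^ 2 :- :1) :* (r :* s :+ q :* p)
         := s :* ((q :^ 2 :- :1) :* r) :+ q :* ((q :^ 2 :- :1) :* p)) ≈-refl q (even j) (q ^ a) p ⟩
  q ^ a * ((q ^ 2 - 1#) * even j) + q * ((q ^ 2 - 1#) * p)
    ≈⟨ +-cong (*-congˡ {q ^ a} (even-η j)) (*-congˡ {q} (part-vertical₁ a j (ℕ.m≤n⇒m≤1+n j≤))) ⟩
  q ^ a * (q * η (suc j) - η j) + q * (q ^ a * (q * q ^ j - η (suc j)))
    ≈⟨ solve 5 (λ q s e e′ t → s :* (q :* e′ :- e) :+ q :* (s :* (q :* t :- e′))
         := s :* (q :* (q :* t) :- e)) ≈-refl q (q ^ a) (η j) (η (suc j)) (q ^ j) ⟩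
  q ^ a * (q * (q * q ^ j) - η j) ∎
  where
  open ≈-Reasoning
  x : ℤ
  x = -ᶻ + a -ᶻ 1ℤ +ᶻ + suc j
  p : Series
  p = part (vertical 1) (+ a , -ᶻ + a -ᶻ 1ℤ +ᶻ + j)
  e₁ : ∀ a j → -ᶻ a -ᶻ 1ℤ +ᶻ (1ℤ +ᶻ j) ≡ -ᶻ a +ᶻ j
  e₁ = solve-∀
  e₂ : ∀ a j → -ᶻ a -ᶻ 1ℤ +ᶻ (1ℤ +ᶻ j) -ᶻ 1ℤ ≡ -ᶻ a -ᶻ 1ℤ +ᶻ j
  e₂ = solve-∀

-- Here the coordinates add up to 2j - 2, and each copy of (0 , 2) lowers this by 2. The parity
-- condition always holds, and 0 to j - 1 copies give a geometric sum of ratio q.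
part-vertical₂ : ∀ a j → j ℕ.≤ suc a →
  (q - 1#) * part (vertical 2) (+ a , -ᶻ + a -ᶻ + 2 +ᶻ + (j ℕ.+ j)) ≈ q ^ a * (q ^ j - 1#)
part-vertical₂ a zero _ = begin
  (q - 1#) * part (vertical 2) (+ a , -ᶻ + a -ᶻ + 2 +ᶻ 0ℤ)
    ≈⟨ *-congˡ {q - 1#} (part-negative sum (0≤ ∷ 0≤ ∷ 0≤ ∷ [])
         {+ a , -ᶻ + a -ᶻ + 2 +ᶻ 0ℤ} (≡neg⇒<0 1 (e (+ a)))) ⟩
  (q - 1#) * 0#
    ≈⟨ solve 2 (λ q x → (q :- :1) :* con 0ℤ := x :* (:1 :- :1)) ≈-refl q (q ^ a) ⟩
  q ^ a * (1# - 1#) ∎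
  where
  open ≈-Reasoning
  e : ∀ a → a +ᶻ (-ᶻ a -ᶻ + 2 +ᶻ 0ℤ) ≡ -ᶻ + 2
  e = solve-∀
part-vertical₂ a (suc j) (s≤s j≤) = begin
  (q - 1#) * part (vertical 2) (+ a , x)
    ≈⟨ *-congˡ {q - 1#} (part-∷ (0ℤ , + 2) diagonals (+ a , x)) ⟩
  (q - 1#) * (part diagonals (+ a , x) + q * part (vertical 2) (+ a -ᶻ 0ℤ , x -ᶻ + 2))
    ≈⟨ *-congˡ {q - 1#} (+-cong
         (≈-trans (part-cong diagonals refl (e₁ (+ a) (+ j)))
           (part-diagonals a (j ℕ.+ j) (ℕ.+-mono-≤ j≤ j≤)))
         (*-congˡ {q} (part-cong (vertical 2) (ℤ.+-identityʳ (+ a)) (e₂ (+ a) (+ j))))) ⟩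
  (q - 1#) * (even (j ℕ.+ j) * q ^ a + q * p)
    ≈⟨ *-congˡ {q - 1#} (+-congʳ {q * p} (*-congʳ {q ^ a} (≈-reflexive (even-n+n j)))) ⟩
  (q - 1#) * (1# * q ^ a + q * p)
    ≈⟨ solve 3 (λ q s p → (q :- :1) :* (:1 :* s :+ q :* p)
         := s :* (q :- :1) :+ q :* ((q :- :1) :* p)) ≈-refl q (q ^ a) p ⟩
  q ^ a * (q - 1#) + q * ((q - 1#) * p)
    ≈⟨ +-congˡ {q ^ a * (q - 1#)} (*-congˡ {q} (part-vertical₂ a j (ℕ.m≤n⇒m≤1+n j≤))) ⟩
  q ^ a * (q - 1#) + q * (q ^ a * (q ^ j - 1#))
    ≈⟨ solve 3 (λ q s t → s :* (q :- :1) :+ q :* (s :* (t :- :1)) := s :* (q :* t :- :1))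
         ≈-refl q (q ^ a) (q ^ j) ⟩
  q ^ a * (q * q ^ j - 1#) ∎
  where
  open ≈-Reasoning
  x : ℤ
  x = -ᶻ + a -ᶻ + 2 +ᶻ + (suc j ℕ.+ suc j)
  p : Series
  p = part (vertical 2) (+ a , -ᶻ + a -ᶻ + 2 +ᶻ + (j ℕ.+ j))
  e₁ : ∀ a j → -ᶻ a -ᶻ + 2 +ᶻ (1ℤ +ᶻ j +ᶻ (1ℤ +ᶻ j)) ≡ -ᶻ a +ᶻ (j +ᶻ j)
  e₁ = solve-∀
  e₂ : ∀ a j → -ᶻ a -ᶻ + 2 +ᶻ (1ℤ +ᶻ j +ᶻ (1ℤ +ᶻ j)) -ᶻ + 2 ≡ -ᶻ a -ᶻ + 2 +ᶻ (j +ᶻ j)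
  e₂ = solve-∀

-- The recurrence in the first coordinate

roots-↭-horizontal : ∀ μ → roots μ ↭ (+ μ , 0ℤ) ∷ vertical μ
roots-↭-horizontal μ =
  ↭-trans (shift (+ μ , 0ℤ) ((1ℤ , 1ℤ) ∷ (1ℤ , -1ℤ) ∷ (0ℤ , + μ) ∷ []) [])
    (prep (+ μ , 0ℤ) (shift (0ℤ , + μ) ((1ℤ , 1ℤ) ∷ (1ℤ , -1ℤ) ∷ []) []))

roots-↭-vertical : ∀ μ →
  roots μ ↭ (0ℤ , + μ) ∷ (1ℤ , 1ℤ) ∷ (1ℤ , -1ℤ) ∷ (+ μ , 0ℤ) ∷ []
roots-↭-vertical μ = shift (0ℤ , + μ) ((1ℤ , 1ℤ) ∷ (1ℤ , -1ℤ) ∷ []) ((+ μ , 0ℤ) ∷ [])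

part-horizontal : ∀ μ a b →
  part (roots μ) (a , b) ≈ part (vertical μ) (a , b) + q * part (roots μ) (a -ᶻ + μ , b)
part-horizontal μ a b = begin
  part (roots μ) (a , b)
    ≈⟨ part-↭ (roots-↭-horizontal μ) (a , b) ⟩
  part ((+ μ , 0ℤ) ∷ vertical μ) (a , b)
    ≈⟨ part-∷ (+ μ , 0ℤ) (vertical μ) (a , b) ⟩
  part (vertical μ) (a , b) + q * part ((+ μ , 0ℤ) ∷ vertical μ) (a -ᶻ + μ , b -ᶻ 0ℤ)
    ≈⟨ +-congˡ {part (vertical μ) (a , b)} (*-congˡ {q} (≈-trans
         (part-cong ((+ μ , 0ℤ) ∷ vertical μ) refl (ℤ.+-identityʳ b))
         (≈-sym (part-↭ (roots-↭-horizontal μ) (a -ᶻ + μ , b))))) ⟩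
  part (vertical μ) (a , b) + q * part (roots μ) (a -ᶻ + μ , b) ∎
  where open ≈-Reasoning

-- Without (0 , μ) every root (c , d) satisfies c ≥ d.
part-vertical-step : ∀ μ a b → a -ᶻ b ℤ.< 0ℤ →
  part (roots μ) (a , b) ≈ q * part (roots μ) (a , b -ᶻ + μ)
part-vertical-step μ a b a-b<0 = begin
  part (roots μ) (a , b)
    ≈⟨ part-↭ (roots-↭-vertical μ) (a , b) ⟩
  part ((0ℤ , + μ) ∷ L) (a , b)
    ≈⟨ part-∷ (0ℤ , + μ) L (a , b) ⟩
  part L (a , b) + q * part ((0ℤ , + μ) ∷ L) (a -ᶻ 0ℤ , b -ᶻ + μ)
    ≈⟨ +-cong (part-negative difference (0≤ ∷ 0≤ ∷ 0≤ ∷ []) {a , b} a-b<0)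
         (*-congˡ {q} (≈-trans
           (part-cong ((0ℤ , + μ) ∷ L) (ℤ.+-identityʳ a) refl)
           (≈-sym (part-↭ (roots-↭-vertical μ) (a , b -ᶻ + μ))))) ⟩
  0# + q * part (roots μ) (a , b -ᶻ + μ)
    ≈⟨ +-identityˡ (q * part (roots μ) (a , b -ᶻ + μ)) ⟩
  q * part (roots μ) (a , b -ᶻ + μ) ∎
  where
  open ≈-Reasoning
  L : List Lattice
  L = (1ℤ , 1ℤ) ∷ (1ℤ , -1ℤ) ∷ (+ μ , 0ℤ) ∷ []

-- The inhomogeneous term of the recurrence: the first two terms of `𝒦` with the root (μ , 0)
-- removed.
𝒟 : ℕ → Lattice → Series
𝒟 μ (a , b) = part (vertical μ) (a , b) - part (vertical μ) (a , -ᶻ b -ᶻ + μ)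

𝒦-recurrence : ∀ μ b n → 𝒦 μ (+ (b ℕ.+ n) , + b) ≈
  q * 𝒦 μ (+ (b ℕ.+ n) -ᶻ + μ , + b) + 𝒟 μ (+ (b ℕ.+ n) , + b)
𝒦-recurrence μ b n = begin
  part (roots μ) (a , + b) - part (roots μ) (a , b′) - part (roots μ) (+ b -ᶻ 1ℤ , a +ᶻ 1ℤ)
    ≈⟨ +-cong (+-cong (part-horizontal μ a (+ b)) (-‿cong (part-horizontal μ a b′)))
         (-‿cong (≈-trans
           -- The third term of `𝒦` has a in its second coordinate, so there it is the root (0 , μ)
           -- that lowers a by μ. The difference of the coordinates is -(n + 2).
           (part-vertical-step μ (+ b -ᶻ 1ℤ) (a +ᶻ 1ℤ) (≡neg⇒<0 (suc n) (e₁ (+ b) (+ n))))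
           (*-congˡ {q} (part-cong (roots μ) refl (e₂ a (+ μ)))))) ⟩
  (v + q * x) - (v′ + q * x′) - q * y
    ≈⟨ solve 6 (λ q v v′ x x′ y → (v :+ q :* x) :- (v′ :+ q :* x′) :- q :* y
         := q :* (x :- x′ :- y) :+ (v :- v′)) ≈-refl q v v′ x x′ y ⟩
  q * (x - x′ - y) + (v - v′) ∎
  where
  open ≈-Reasoning
  a b′ : ℤ
  a = + (b ℕ.+ n)
  b′ = -ᶻ + b -ᶻ + μ
  v v′ x x′ y : Series
  v  = part (vertical μ) (a , + b)
  v′ = part (vertical μ) (a , b′)
  x  = part (roots μ) (a -ᶻ + μ , + b)
  x′ = part (roots μ) (a -ᶻ + μ , b′)
  y  = part (roots μ) (+ b -ᶻ 1ℤ , a -ᶻ + μ +ᶻ 1ℤ)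
  e₁ : ∀ b n → b -ᶻ 1ℤ -ᶻ (b +ᶻ n +ᶻ 1ℤ) ≡ -ᶻ (+ 2 +ᶻ n)
  e₁ = solve-∀
  e₂ : ∀ a μ → a +ᶻ 1ℤ -ᶻ μ ≡ a -ᶻ μ +ᶻ 1ℤ
  e₂ = solve-∀

𝒟₁ : ∀ b n → let y = q ^ b; z = q ^ n in
  (q ^ 2 - 1#) * 𝒟 1 (+ (b ℕ.+ n) , + b) ≈
  y * z * ((q * (q * (y * y * z)) - η n) - (q * z - η (suc n)))
𝒟₁ b n = begin
  (q ^ 2 - 1#) * (part (vertical 1) (+ a , + b) - part (vertical 1) (+ a , -ᶻ + b -ᶻ 1ℤ))
    ≈⟨ *-congˡ {q ^ 2 - 1#} (+-cong
         (part-cong (vertical 1) refl (e₁ (+ b) (+ n)))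
         (-‿cong (part-cong (vertical 1) refl (e₂ (+ b) (+ n))))) ⟩
  (q ^ 2 - 1#) * (p - p′)
    ≈⟨ solve 3 (λ q p p′ → (q :^ 2 :- :1) :* (p :- p′)
         := (q :^ 2 :- :1) :* p :- (q :^ 2 :- :1) :* p′) ≈-refl q p p′ ⟩
  (q ^ 2 - 1#) * p - (q ^ 2 - 1#) * p′
    -- The points (a , b) and (a , -b-1) have coordinate sums 2b + n and n - 1, so j is 2b + n + 1
    -- and n respectively.
    ≈⟨ +-cong (part-vertical₁ a (suc (b ℕ.+ b ℕ.+ n)) (s≤s 2b+n≤2a))
         (-‿cong (part-vertical₁ a n (ℕ.m≤n⇒m≤1+n (ℕ.≤-trans (ℕ.m≤n+m n b) (ℕ.m≤m+n a a))))) ⟩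
  q ^ a * (q * (q * q ^ (b ℕ.+ b ℕ.+ n)) - η (b ℕ.+ b ℕ.+ n)) - q ^ a * (q * q ^ n - η (suc n))
    ≈⟨ +-cong
         (*-cong (^-homo-* q b n) (+-cong
           (*-congˡ {q} (*-congˡ {q}
             (≈-trans (^-homo-* q (b ℕ.+ b) n) (*-congʳ {q ^ n} (^-homo-* q b b)))))
           (-‿cong (≈-reflexive (η-n+n+ b n)))))
         (-‿cong (*-congʳ {q * q ^ n - η (suc n)} (^-homo-* q b n))) ⟩
  y * z * (q * (q * (y * y * z)) - η n) - y * z * (q * z - η (suc n))
    ≈⟨ solve 3 (λ x u v → x :* u :- x :* v := x :* (u :- v)) ≈-refl
         (y * z) (q * (q * (y * y * z)) - η n) (q * z - η (suc n)) ⟩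
  y * z * ((q * (q * (y * y * z)) - η n) - (q * z - η (suc n))) ∎
  where
  open ≈-Reasoning
  a : ℕ
  a = b ℕ.+ n
  y z p p′ : Series
  y  = q ^ b
  z  = q ^ n
  p  = part (vertical 1) (+ a , -ᶻ + a -ᶻ 1ℤ +ᶻ + suc (b ℕ.+ b ℕ.+ n))
  p′ = part (vertical 1) (+ a , -ᶻ + a -ᶻ 1ℤ +ᶻ + n)
  e₁ : ∀ b n → b ≡ -ᶻ (b +ᶻ n) -ᶻ 1ℤ +ᶻ (1ℤ +ᶻ (b +ᶻ b +ᶻ n))
  e₁ = solve-∀
  e₂ : ∀ b n → -ᶻ b -ᶻ 1ℤ ≡ -ᶻ (b +ᶻ n) -ᶻ 1ℤ +ᶻ n
  e₂ = solve-∀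
  2b+n≤2a : b ℕ.+ b ℕ.+ n ℕ.≤ a ℕ.+ a
  2b+n≤2a = subst (ℕ._≤ a ℕ.+ a) (sym (ℕ.+-assoc b b n)) (ℕ.+-monoˡ-≤ a (ℕ.m≤m+n b n))

𝒟₂ : ∀ b k → let y = q ^ b; z = q ^ k in
  (q - 1#) * 𝒟 2 (+ (b ℕ.+ (k ℕ.+ k)) , + b) ≈ y * (z * z) * (q * (y * z) - z)
𝒟₂ b k = begin
  (q - 1#) * (part (vertical 2) (+ a , + b) - part (vertical 2) (+ a , -ᶻ + b -ᶻ + 2))
    ≈⟨ *-congˡ {q - 1#} (+-cong
         (part-cong (vertical 2) refl (e₁ (+ b) (+ k)))
         (-‿cong (part-cong (vertical 2) refl (e₂ (+ b) (+ k))))) ⟩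
  (q - 1#) * (p - p′)
    ≈⟨ solve 3 (λ q p p′ → (q :- :1) :* (p :- p′) := (q :- :1) :* p :- (q :- :1) :* p′)
         ≈-refl q p p′ ⟩
  (q - 1#) * p - (q - 1#) * p′
    -- The points (a , b) and (a , -b-2) have coordinate sums 2(b + k) and 2k - 2, so j is b + k + 1
    -- and k respectively.
    ≈⟨ +-cong (part-vertical₂ a (suc (b ℕ.+ k)) (s≤s (ℕ.+-monoʳ-≤ b (ℕ.m≤m+n k k))))
         (-‿cong (part-vertical₂ a k
           (ℕ.m≤n⇒m≤1+n (ℕ.≤-trans (ℕ.m≤m+n k k) (ℕ.m≤n+m (k ℕ.+ k) b))))) ⟩
  q ^ a * (q * q ^ (b ℕ.+ k) - 1#) - q ^ a * (z - 1#)
    ≈⟨ solve 4 (λ q x u z → x :* (q :* u :- :1) :- x :* (z :- :1) := x :* (q :* u :- z))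
         ≈-refl q (q ^ a) (q ^ (b ℕ.+ k)) z ⟩
  q ^ a * (q * q ^ (b ℕ.+ k) - z)
    ≈⟨ *-cong (≈-trans (^-homo-* q b (k ℕ.+ k)) (*-congˡ {y} (^-homo-* q k k)))
         (+-congʳ { - z} (*-congˡ {q} (^-homo-* q b k))) ⟩
  y * (z * z) * (q * (y * z) - z) ∎
  where
  open ≈-Reasoning
  a : ℕ
  a = b ℕ.+ (k ℕ.+ k)
  y z p p′ : Series
  y  = q ^ b
  z  = q ^ k
  p  = part (vertical 2) (+ a , -ᶻ + a -ᶻ + 2 +ᶻ + (suc (b ℕ.+ k) ℕ.+ suc (b ℕ.+ k)))
  p′ = part (vertical 2) (+ a , -ᶻ + a -ᶻ + 2 +ᶻ + (k ℕ.+ k))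
  e₁ : ∀ b k → b ≡ -ᶻ (b +ᶻ (k +ᶻ k)) -ᶻ + 2 +ᶻ (1ℤ +ᶻ (b +ᶻ k) +ᶻ (1ℤ +ᶻ (b +ᶻ k)))
  e₁ = solve-∀
  e₂ : ∀ b k → -ᶻ b -ᶻ + 2 ≡ -ᶻ (b +ᶻ (k +ᶻ k)) -ᶻ + 2 +ᶻ (k +ᶻ k)
  e₂ = solve-∀

-- Solution of the recurrence

denominator-*-step : ∀ x d X D → denominator q * x ≈ X → denominator q * d ≈ D →
  denominator q * (q * x + d) ≈ q * X + D
denominator-*-step x d X D x≈ d≈ = begin
  denominator q * (q * x + d)
    ≈⟨ solve 4 (λ h q x d → h :* (q :* x :+ d) := q :* (h :* x) :+ h :* d)
         ≈-refl (denominator q) q x d ⟩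
  q * (denominator q * x) + denominator q * d
    ≈⟨ +-cong (*-congˡ {q} x≈) d≈ ⟩
  q * X + D ∎
  where open ≈-Reasoning

denominator-*-𝒟₁ : ∀ b n → let y = q ^ b; z = q ^ n in
  denominator q * 𝒟 1 (+ (b ℕ.+ n) , + b) ≈ difference₁ q y z (η n)
denominator-*-𝒟₁ b n = begin
  (q - 1#) * (q ^ 2 - 1#) * d
    ≈⟨ solve 2 (λ q d → (q :- :1) :* (q :^ 2 :- :1) :* d := (q :- :1) :* ((q :^ 2 :- :1) :* d))
         ≈-refl q d ⟩
  (q - 1#) * ((q ^ 2 - 1#) * d)
    ≈⟨ *-congˡ {q - 1#} (𝒟₁ b n) ⟩
  (q - 1#) * (y * z * (u - (q * z - η (suc n))))
    ≈⟨ *-congˡ {q - 1#} (*-congˡ {y * z} (+-congˡ {u}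
         (-‿cong (+-congˡ {q * z} (-‿cong (η-suc n)))))) ⟩
  (q - 1#) * (y * z * (u - (q * z - (1# + q - η n)))) ∎
  where
  open ≈-Reasoning
  d y z u : Series
  d = 𝒟 1 (+ (b ℕ.+ n) , + b)
  y = q ^ b
  z = q ^ n
  u = q * (q * (y * y * z)) - η n

denominator-*-𝒟₂ : ∀ b k → let y = q ^ b; z = q ^ k in
  denominator q * 𝒟 2 (+ (b ℕ.+ (k ℕ.+ k)) , + b) ≈ difference₂ q y z
denominator-*-𝒟₂ b k = begin
  (q - 1#) * (q ^ 2 - 1#) * d
    ≈⟨ solve 2 (λ q d → (q :- :1) :* (q :^ 2 :- :1) :* d := (q :^ 2 :- :1) :* ((q :- :1) :* d))
         ≈-refl q d ⟩
  (q ^ 2 - 1#) * ((q - 1#) * d)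
    ≈⟨ *-congˡ {q ^ 2 - 1#} (𝒟₂ b k) ⟩
  (q ^ 2 - 1#) * (q ^ b * (q ^ k * q ^ k) * (q * (q ^ b * q ^ k) - q ^ k)) ∎
  where
  open ≈-Reasoning
  d : Series
  d = 𝒟 2 (+ (b ℕ.+ (k ℕ.+ k)) , + b)

-- λ = (b − 1 , b) is fixed by the dot action of a reflection.
𝒦₁-wall : ∀ b → 𝒦 1 (+ b -ᶻ 1ℤ , + b) ≈ 0#
𝒦₁-wall b = begin
  p - p′ - part (roots 1) (+ b -ᶻ 1ℤ , + b -ᶻ 1ℤ +ᶻ 1ℤ)
    ≈⟨ +-cong (+-congˡ {p} (-‿cong
           (part-negative sum (0≤ ∷ 0≤ ∷ 0≤ ∷ 0≤ ∷ []) {+ b -ᶻ 1ℤ , -ᶻ + b -ᶻ 1ℤ}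
             (≡neg⇒<0 1 (e₁ (+ b))))))
         (-‿cong (part-cong (roots 1) refl (e₂ (+ b)))) ⟩
  p - 0# - p
    ≈⟨ solve 1 (λ p → p :- con 0ℤ :- p := con 0ℤ) ≈-refl p ⟩
  0# ∎
  where
  open ≈-Reasoning
  p p′ : Series
  p  = part (roots 1) (+ b -ᶻ 1ℤ , + b)
  p′ = part (roots 1) (+ b -ᶻ 1ℤ , -ᶻ + b -ᶻ 1ℤ)
  e₁ : ∀ b → b -ᶻ 1ℤ +ᶻ (-ᶻ b -ᶻ 1ℤ) ≡ -ᶻ + 2
  e₁ = solve-∀
  e₂ : ∀ b → b -ᶻ 1ℤ +ᶻ 1ℤ ≡ b
  e₂ = solve-∀

-- Induction on n = λ₂ - λ₁, starting from the wall at λ₂ = λ₁ - 1. Each step changes λ₂ by one, so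
-- the parity parameter alternates.
𝒦₁-closed : ∀ b n → let y = q ^ b; z = q ^ n in
  denominator q * 𝒦 1 (+ (b ℕ.+ n) , + b) ≈ closed q (y * z) (y * y) z (η n)
𝒦₁-closed b zero    = begin
  denominator q * 𝒦 1 (+ (b ℕ.+ 0) , + b)
    ≈⟨ *-congˡ {denominator q} (𝒦-recurrence 1 b 0) ⟩
  denominator q * (q * 𝒦 1 (+ (b ℕ.+ 0) -ᶻ 1ℤ , + b) + 𝒟 1 (+ (b ℕ.+ 0) , + b))
    ≈⟨ denominator-*-step
         (𝒦 1 (+ (b ℕ.+ 0) -ᶻ 1ℤ , + b)) (𝒟 1 (+ (b ℕ.+ 0) , + b)) 0# (difference₁ q y 1# 1#)
         (≈-trans (*-congˡ {denominator q} wall) (zeroʳ (denominator q)))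
         (denominator-*-𝒟₁ b 0) ⟩
  q * 0# + difference₁ q y 1# 1#
    ≈⟨ closed₁-base q y ⟩
  closed q (y * 1#) (y * y) 1# 1# ∎
  where
  open ≈-Reasoning
  y : Series
  y = q ^ b
  wall : 𝒦 1 (+ (b ℕ.+ 0) -ᶻ 1ℤ , + b) ≈ 0#
  wall = ≈-trans
    (≈-reflexive (cong (λ a → 𝒦 1 (+ a -ᶻ 1ℤ , + b)) (ℕ.+-identityʳ b))) (𝒦₁-wall b)
𝒦₁-closed b (suc n) = begin
  denominator q * 𝒦 1 (+ (b ℕ.+ suc n) , + b)
    ≈⟨ *-congˡ {denominator q} (𝒦-recurrence 1 b (suc n)) ⟩
  denominator q * (q * 𝒦 1 (+ (b ℕ.+ suc n) -ᶻ 1ℤ , + b) + 𝒟 1 (+ (b ℕ.+ suc n) , + b))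
    ≈⟨ denominator-*-step
         (𝒦 1 (+ (b ℕ.+ suc n) -ᶻ 1ℤ , + b)) (𝒟 1 (+ (b ℕ.+ suc n) , + b))
         (closed q (y * z) (y * y) z (η n)) (difference₁ q y (q * z) (η (suc n)))
         (≈-trans (*-congˡ {denominator q} previous) (𝒦₁-closed b n))
         (denominator-*-𝒟₁ b (suc n)) ⟩
  q * closed q (y * z) (y * y) z (η n) + difference₁ q y (q * z) (η (suc n))
    ≈⟨ +-congˡ {q * closed q (y * z) (y * y) z (η n)}
         (difference₁-cong q y (q * z) (η-suc n)) ⟩
  q * closed q (y * z) (y * y) z (η n) + difference₁ q y (q * z) (1# + q - η n)
    ≈⟨ closed₁-step q y z (η n) ⟩
  closed q (y * (q * z)) (y * y) (q * z) (1# + q - η n)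
    ≈⟨ closed-cong q (y * (q * z)) (y * y) (q * z) (η-suc n) ⟨
  closed q (y * (q * z)) (y * y) (q * z) (η (suc n)) ∎
  where
  open ≈-Reasoning
  y z : Series
  y = q ^ b
  z = q ^ n
  e₁ : ∀ b n → b +ᶻ (1ℤ +ᶻ n) -ᶻ 1ℤ ≡ b +ᶻ n
  e₁ = solve-∀
  previous : 𝒦 1 (+ (b ℕ.+ suc n) -ᶻ 1ℤ , + b) ≈ 𝒦 1 (+ (b ℕ.+ n) , + b)
  previous = ≈-reflexive (cong (λ a → 𝒦 1 (a , + b)) (e₁ (+ b) (+ n)))

-- The recurrence leads here from (0 , 0); all three terms have a negative first coordinate.
𝒦₂-wall : 𝒦 2 (-ᶻ + 2 , 0ℤ) ≈ 0#
𝒦₂-wall = begin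
  part (roots 2) (-ᶻ + 2 , 0ℤ) - part (roots 2) (-ᶻ + 2 , -ᶻ + 2) - part (roots 2) (-1ℤ , -1ℤ)
    ≈⟨ +-cong (+-cong (outside 1 0ℤ) (-‿cong (outside 1 (-ᶻ + 2)))) (-‿cong (outside 0 -1ℤ)) ⟩
  0# - 0# - 0#
    ≈⟨ solve 0 (con 0ℤ :- con 0ℤ :- con 0ℤ := con 0ℤ) ≈-refl ⟩
  0# ∎
  where
  open ≈-Reasoning
  outside : ∀ a b → part (roots 2) (-[1+ a ] , b) ≈ 0#
  outside a b = part-negative first (0≤ ∷ 0≤ ∷ 0≤ ∷ 0≤ ∷ []) { -[1+ a ] , b} -<+

-- The dot action of the reflection exchanging the coordinates.
𝒦₂-reflection : ∀ b → 𝒦 2 (+ suc b -ᶻ + 2 , + suc b) ≈ - 𝒦 2 (+ b , + b)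
𝒦₂-reflection b = begin
  part (roots 2) (+ suc b -ᶻ + 2 , + suc b) - part (roots 2) (+ suc b -ᶻ + 2 , -ᶻ + suc b -ᶻ + 2)
      - part (roots 2) (+ suc b -ᶻ 1ℤ , + suc b -ᶻ + 2 +ᶻ 1ℤ)
    ≈⟨ +-cong (+-cong (part-cong (roots 2) (e₁ (+ b)) (ℤ.+-comm 1ℤ (+ b)))
           (-‿cong (outside {+ suc b -ᶻ + 2} 3 (e₂ (+ b)))))
         (-‿cong (part-cong (roots 2) (e₃ (+ b)) (e₄ (+ b)))) ⟩
  p′ - 0# - p
    ≈⟨ solve 2 (λ p p′ → p′ :- con 0ℤ :- p := :- (p :- con 0ℤ :- p′)) ≈-refl p p′ ⟩
  - (p - 0# - p′)
    ≈⟨ -‿cong (+-congʳ { - p′} (+-congˡ {p} (-‿cong (outside {+ b} 1 (e₅ (+ b)))))) ⟨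
  - (p - part (roots 2) (+ b , -ᶻ + b -ᶻ + 2) - p′) ∎
  where
  open ≈-Reasoning
  p p′ : Series
  p  = part (roots 2) (+ b , + b)
  p′ = part (roots 2) (+ b -ᶻ 1ℤ , + b +ᶻ 1ℤ)
  outside : ∀ {x y} n → x +ᶻ y ≡ -ᶻ + suc n → part (roots 2) (x , y) ≈ 0#
  outside {x} {y} n eq = part-negative sum (0≤ ∷ 0≤ ∷ 0≤ ∷ 0≤ ∷ []) {x , y} (≡neg⇒<0 n eq)
  e₁ : ∀ b → 1ℤ +ᶻ b -ᶻ + 2 ≡ b -ᶻ 1ℤ
  e₁ = solve-∀
  e₂ : ∀ b → 1ℤ +ᶻ b -ᶻ + 2 +ᶻ (-ᶻ (1ℤ +ᶻ b) -ᶻ + 2) ≡ -ᶻ + 4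
  e₂ = solve-∀
  e₃ : ∀ b → 1ℤ +ᶻ b -ᶻ 1ℤ ≡ b
  e₃ = solve-∀
  e₄ : ∀ b → 1ℤ +ᶻ b -ᶻ + 2 +ᶻ 1ℤ ≡ b
  e₄ = solve-∀
  e₅ : ∀ b → b +ᶻ (-ᶻ b -ᶻ + 2) ≡ -ᶻ + 2
  e₅ = solve-∀

-- The value X at (b-2 , b) is left open: it is 0 for b = 0 and comes from the reflection otherwise.
𝒦₂-diagonal-step : ∀ b X → denominator q * 𝒦 2 (+ b -ᶻ + 2 , + b) ≈ X →
  denominator q * 𝒦 2 (+ b , + b) ≈ q * X + difference₂ q (q ^ b) 1#
𝒦₂-diagonal-step b X eq = begin
  denominator q * 𝒦 2 (+ b , + b)
    ≈⟨ *-congˡ {denominator q} (≈-trans (𝒦-n+0 (λ a → a)) (𝒦-recurrence 2 b 0)) ⟩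
  denominator q * (q * 𝒦 2 (+ (b ℕ.+ 0) -ᶻ + 2 , + b) + 𝒟 2 (+ (b ℕ.+ 0) , + b))
    ≈⟨ denominator-*-step
         (𝒦 2 (+ (b ℕ.+ 0) -ᶻ + 2 , + b)) (𝒟 2 (+ (b ℕ.+ 0) , + b)) X (difference₂ q (q ^ b) 1#)
         (≈-trans (*-congˡ {denominator q} (≈-sym (𝒦-n+0 (_-ᶻ + 2)))) eq)
         (denominator-*-𝒟₂ b 0) ⟩
  q * X + difference₂ q (q ^ b) 1# ∎
  where
  open ≈-Reasoning
  𝒦-n+0 : ∀ f → 𝒦 2 (f (+ b) , + b) ≈ 𝒦 2 (f (+ (b ℕ.+ 0)) , + b)
  𝒦-n+0 f = ≈-reflexive (cong (λ a → 𝒦 2 (f (+ a) , + b)) (sym (ℕ.+-identityʳ b)))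

𝒦₂-diagonal : ∀ b → denominator q * 𝒦 2 (+ b , + b) ≈ closed q (q ^ b) (q ^ b) 1# (η b)
𝒦₂-diagonal zero    = begin
  denominator q * 𝒦 2 (0ℤ , 0ℤ)
    ≈⟨ 𝒦₂-diagonal-step 0 0# (≈-trans (*-congˡ {denominator q} 𝒦₂-wall) (zeroʳ (denominator q))) ⟩
  q * 0# + difference₂ q 1# 1#
    ≈⟨ closed₂-base q ⟩
  closed q 1# 1# 1# 1# ∎
  where open ≈-Reasoning
𝒦₂-diagonal (suc b) = begin
  denominator q * 𝒦 2 (+ suc b , + suc b)
    ≈⟨ 𝒦₂-diagonal-step (suc b) (- closed q y y 1# (η b)) (begin
         denominator q * 𝒦 2 (+ suc b -ᶻ + 2 , + suc b)
           ≈⟨ *-congˡ {denominator q} (𝒦₂-reflection b) ⟩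
         denominator q * - 𝒦 2 (+ b , + b)
           ≈⟨ -‿distribʳ-* (denominator q) (𝒦 2 (+ b , + b)) ⟨
         - (denominator q * 𝒦 2 (+ b , + b))
           ≈⟨ -‿cong (𝒦₂-diagonal b) ⟩
         - closed q y y 1# (η b) ∎) ⟩
  q * - closed q y y 1# (η b) + difference₂ q (q * y) 1#
    ≈⟨ closed₂-diagonal q y (η b) ⟩
  closed q (q * y) (q * y) 1# (1# + q - η b)
    ≈⟨ closed-cong q (q * y) (q * y) 1# (η-suc b) ⟨
  closed q (q * y) (q * y) 1# (η (suc b)) ∎
  where
  open ≈-Reasoning
  y : Series
  y = q ^ b

-- Each step changes λ₂ by two and starts from the diagonal, so λ₂ - λ₁ is even throughout and the
-- parity parameter depends on λ₁ alone.
𝒦₂-closed : ∀ b k → let y = q ^ b; z = q ^ k in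
  denominator q * 𝒦 2 (+ (b ℕ.+ (k ℕ.+ k)) , + b) ≈ closed q (y * z) y (z * z) (η b)
𝒦₂-closed b zero    = begin
  denominator q * 𝒦 2 (+ (b ℕ.+ 0) , + b)
    ≈⟨ ≈-reflexive (cong (λ a → denominator q * 𝒦 2 (+ a , + b)) (ℕ.+-identityʳ b)) ⟩
  denominator q * 𝒦 2 (+ b , + b)
    ≈⟨ 𝒦₂-diagonal b ⟩
  closed q y y 1# (η b)
    ≈⟨ closed₂-unit q y (η b) ⟩
  closed q (y * 1#) y (1# * 1#) (η b) ∎
  where
  open ≈-Reasoning
  y : Series
  y = q ^ b
𝒦₂-closed b (suc k) = begin
  denominator q * 𝒦 2 (+ a , + b)
    ≈⟨ *-congˡ {denominator q} (𝒦-recurrence 2 b (suc k ℕ.+ suc k)) ⟩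
  denominator q * (q * 𝒦 2 (+ a -ᶻ + 2 , + b) + 𝒟 2 (+ a , + b))
    ≈⟨ denominator-*-step
         (𝒦 2 (+ a -ᶻ + 2 , + b)) (𝒟 2 (+ a , + b))
         (closed q (y * z) y (z * z) (η b)) (difference₂ q y (q * z))
         (≈-trans (*-congˡ {denominator q} previous) (𝒦₂-closed b k))
         (denominator-*-𝒟₂ b (suc k)) ⟩
  q * closed q (y * z) y (z * z) (η b) + difference₂ q y (q * z)
    ≈⟨ closed₂-step q y z (η b) ⟩
  closed q (y * (q * z)) y (q * z * (q * z)) (η b) ∎
  where
  open ≈-Reasoning
  a : ℕ
  a = b ℕ.+ (suc k ℕ.+ suc k)
  y z : Series
  y = q ^ b
  z = q ^ k
  e₁ : ∀ b k → b +ᶻ (1ℤ +ᶻ k +ᶻ (1ℤ +ᶻ k)) -ᶻ + 2 ≡ b +ᶻ (k +ᶻ k)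
  e₁ = solve-∀
  previous : 𝒦 2 (+ a -ᶻ + 2 , + b) ≈ 𝒦 2 (+ (b ℕ.+ (k ℕ.+ k)) , + b)
  previous = ≈-reflexive (cong (λ a → 𝒦 2 (a , + b)) (e₁ (+ b) (+ k)))

-- Weights outside the root lattice of C₂

part-odd : ∀ {L} → All (λ α → + 2 ℤ∣.∣ ⟨ sum ⟩ α) L →
           ∀ {β} → ¬ + 2 ℤ∣.∣ ⟨ sum ⟩ β → part L β ≈ 0#
part-odd evens = part-vanish (λ β → ¬ + 2 ℤ∣.∣ ⟨ sum ⟩ β)
  (λ odd → odd (ℤ∣.divides 0ℤ refl)) (All.map stays evens)
  where
  stays : ∀ {α} → + 2 ℤ∣.∣ ⟨ sum ⟩ α →
    ∀ {β} → ¬ + 2 ℤ∣.∣ ⟨ sum ⟩ β → ¬ + 2 ℤ∣.∣ ⟨ sum ⟩ (β ⊝ α)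
  stays {α} 2∣α {β} odd 2∣β-α = odd (ℤ∣.∣m+n∣n⇒∣m
    (subst (+ 2 ℤ∣.∣_) (⟨⊝⟩ sum β α) 2∣β-α) (ℤ∣.∣m⇒∣-m 2∣α))

-- The three arguments have coordinate sums 2b + n, n - 2 and 2b + n, all odd, whereas every root of
-- C₂ has an even coordinate sum.
𝒦₂-odd : ∀ b n → 2 ∤ n → 𝒦 2 (+ (b ℕ.+ n) , + b) ≈ 0#
𝒦₂-odd b n 2∤n = begin
  𝒦 2 (+ (b ℕ.+ n) , + b)
    ≈⟨ +-cong (+-cong (odd {+ (b ℕ.+ n)} (+ b) (e₁ (+ b) (+ n)))
           (-‿cong (odd {+ (b ℕ.+ n)} -1ℤ (e₂ (+ b) (+ n)))))
         (-‿cong (odd {+ b -ᶻ 1ℤ} (+ b) (e₃ (+ b) (+ n)))) ⟩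
  0# - 0# - 0#
    ≈⟨ solve 0 (con 0ℤ :- con 0ℤ :- con 0ℤ := con 0ℤ) ≈-refl ⟩
  0# ∎
  where
  open ≈-Reasoning
  odd : ∀ {x y} i → x +ᶻ y ≡ i *ᶻ + 2 +ᶻ + n → part (roots 2) (x , y) ≈ 0#
  odd {x} {y} i eq = part-odd
    (ℤ∣.divides 1ℤ refl ∷ ℤ∣.divides 0ℤ refl ∷ ℤ∣.divides 1ℤ refl ∷ ℤ∣.divides 1ℤ refl ∷ []) {x , y}
    λ 2∣ → 2∤n (ℤ∣.∣⇒∣ᵤ (ℤ∣.∣m+n∣m⇒∣n (subst (+ 2 ℤ∣.∣_) eq 2∣) (ℤ∣.divides i refl)))
  e₁ : ∀ b n → b +ᶻ n +ᶻ b ≡ b *ᶻ + 2 +ᶻ n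
  e₁ = solve-∀
  e₂ : ∀ b n → b +ᶻ n +ᶻ (-ᶻ b -ᶻ + 2) ≡ -1ℤ *ᶻ + 2 +ᶻ n
  e₂ = solve-∀
  e₃ : ∀ b n → b -ᶻ 1ℤ +ᶻ (b +ᶻ n +ᶻ 1ℤ) ≡ b *ᶻ + 2 +ᶻ n
  e₃ = solve-∀

-- Parity of natural numbers

even⇒double : ∀ {n} → 2 ∣ n → ∃ λ k → n ≡ k ℕ.+ k
even⇒double (divides k eq) =
  k , trans eq (trans (ℕ.*-comm k 2) (cong (k ℕ.+_) (ℕ.+-identityʳ k)))

η-even : ∀ {n} → 2 ∣ n → η n ≡ 1#
η-even (divides k refl) = η-k*2 k
  where
  η-k*2 : ∀ k → η (k ℕ.* 2) ≡ 1#
  η-k*2 zero    = refl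
  η-k*2 (suc k) = η-k*2 k

∤-pred² : ∀ {n} → 2 ∤ suc (suc n) → 2 ∤ n
∤-pred² 2∤2+n 2∣n = 2∤2+n (∣m∣n⇒∣m+n ∣-refl 2∣n)

η-odd : ∀ n → 2 ∤ n → η n ≡ q
η-odd zero          2∤0 = ⊥-elim (2∤0 (divides 0 refl))
η-odd (suc zero)    _   = refl
η-odd (suc (suc n)) 2∤n = η-odd n (∤-pred² 2∤n)

odd⇒suc-even : ∀ n → 2 ∤ n → 2 ∣ suc n
odd⇒suc-even zero          2∤0 = ⊥-elim (2∤0 (divides 0 refl))
odd⇒suc-even (suc zero)    _   = ∣-refl
odd⇒suc-even (suc (suc n)) 2∤n = ∣m∣n⇒∣m+n ∣-refl (odd⇒suc-even n (∤-pred² 2∤n))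

odd+odd : ∀ {m n} → 2 ∤ m → 2 ∤ n → 2 ∣ m ℕ.+ n
odd+odd {m} {n} 2∤m 2∤n = ∣m+n∣m⇒∣n
  (subst (2 ∣_) (cong suc (ℕ.+-suc m n)) (∣m∣n⇒∣m+n (odd⇒suc-even m 2∤m) (odd⇒suc-even n 2∤n)))
  ∣-refl

m+n+m≡m*2+n : ∀ m n → m ℕ.+ n ℕ.+ m ≡ m ℕ.* 2 ℕ.+ n
m+n+m≡m*2+n = solve-∀ⁿ

odd-difference : ∀ {m n} → 2 ∤ m ℕ.+ n → 2 ∤ m → 2 ∣ n
odd-difference {m} {n} 2∤m+n 2∤m with 2 ∣? n
... | yes 2∣n = 2∣n
... | no  2∤n = ⊥-elim (2∤m+n (odd+odd 2∤m 2∤n))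

mixed-difference : ∀ m {n} → ¬ (2 ∣ m ℕ.+ n × 2 ∣ m) → ¬ (2 ∤ m ℕ.+ n × 2 ∤ m) → 2 ∤ n
mixed-difference m {n} ¬even ¬odd 2∣n with 2 ∣? m
... | yes 2∣m = ¬even (∣m∣n⇒∣m+n 2∣m 2∣n , 2∣m)
... | no  2∤m = ¬odd
  ((λ 2∣m+n → 2∤m (∣m+n∣m⇒∣n (subst (2 ∣_) (ℕ.+-comm m n) 2∣m+n) 2∣n)) , 2∤m)

[m+k+k+m]/2≡m+k : ∀ m k → (m ℕ.+ (k ℕ.+ k) ℕ.+ m) ℕ./ 2 ≡ m ℕ.+ k
[m+k+k+m]/2≡m+k m k = trans (cong (ℕ._/ 2) (rearrange m k)) (m*n/n≡m (m ℕ.+ k) 2)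
  where
  rearrange : ∀ m k → m ℕ.+ (k ℕ.+ k) ℕ.+ m ≡ (m ℕ.+ k) ℕ.* 2
  rearrange = solve-∀ⁿ

-- Powers of q and division by the denominator

q^-≡ : ∀ {m n} → m ≡ n → q ^ m ≈ q ^ n
q^-≡ eq = ≈-reflexive (cong (q ^_) eq)

q^[n+1] : ∀ n → q ^ (n ℕ.+ 1) ≈ q * q ^ n
q^[n+1] n = q^-≡ (ℕ.+-comm n 1)

q^[n+2] : ∀ n → q ^ (n ℕ.+ 2) ≈ q ^ 2 * q ^ n
q^[n+2] n = ≈-trans (^-homo-* q n 2) (*-comm (q ^ n) (q ^ 2))

q^2* : ∀ n → q ^ (2 ℕ.* n) ≈ q ^ n * q ^ n
q^2* n = ≈-trans (q^-≡ (cong (n ℕ.+_) (ℕ.+-identityʳ n))) (^-homo-* q n n)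

-1-cong : ∀ {f g} → f ≈ g → f - 1# ≈ g - 1#
-1-cong = +-congʳ { - 1#}

denominator-cancel : ∀ k f g → denominator q * k ≈ g → denominator q * f ≈ g → k ≈ f
denominator-cancel k f g dk≈g df≈g = *-cancelˡ (denominator q) {k} {f} (≈-trans dk≈g (≈-sym df≈g))

-- Both sides agree after multiplication by (q - 1)(q² - 1), which has constant term 1 and can be
-- cancelled.
≈-fractions : ∀ κ s t f g h c → denominator q * κ ≈ c → cleared q s t f g h ≈ c →
  κ ≈ s * (f / (q ^ 2 - 1#) + t * (g / (q - 1#)) * (h / (q ^ 2 - 1#)))
≈-fractions κ s t f g h c dκ≈c cleared≈c =
  denominator-cancel κ (fractions s t (f / (q ^ 2 - 1#)) (g / (q - 1#)) (h / (q ^ 2 - 1#))) c dκ≈c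
    (≈-trans
      (clear q s t {f / (q ^ 2 - 1#)} {g / (q - 1#)} {h / (q ^ 2 - 1#)} {f} {g} {h}
        (*-/-cancel f (q ^ 2 - 1#)) (*-/-cancel g (q - 1#)) (*-/-cancel h (q ^ 2 - 1#)))
      cleared≈c)

≈-triple : ∀ κ s g h c → denominator q * κ ≈ c → triple s g h ≈ c →
  κ ≈ s * (g / (q - 1#)) * (h / (q ^ 2 - 1#))
≈-triple κ s g h c dκ≈c triple≈c =
  denominator-cancel κ (triple s (g / (q - 1#)) (h / (q ^ 2 - 1#))) c dκ≈c
    (≈-trans
      (clear-triple q s {g / (q - 1#)} {h / (q ^ 2 - 1#)} {g} {h}
        (*-/-cancel g (q - 1#)) (*-/-cancel h (q ^ 2 - 1#)))
      triple≈c)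

-- The nonzero cases

module _ (b : ℕ) where
  private
    y : Series
    y = q ^ b

  C₂-even : ∀ {n} → 2 ∣ b → ∃ (λ k → n ≡ k ℕ.+ k) → let a = b ℕ.+ n in
    K C₂ (weight a b) 0ʷ ≈ q ^ ((a ℕ.+ b) ℕ./ 2) *
      ( (q ^ (b ℕ.+ 2) - 1#) / (q ^ 2 - 1#)
      + q ^ 2 * ((q ^ (b ℕ.+ 1) - 1#) / (q - 1#)) * ((q ^ (a ∸ b) - 1#) / (q ^ 2 - 1#)) )
  C₂-even 2∣b (k , refl) = ≈-trans (K-C₂ b (k ℕ.+ k))
    (≈-fractions (𝒦 2 (+ a , + b)) S (q ^ 2) F G H (closed q (y * z) y (z * z) (η b))
      (𝒦₂-closed b k) (begin
        cleared q S (q ^ 2) F G H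
          ≈⟨ cleared-cong q (q ^ 2) {S} {y * z} {F} {q ^ 2 * y - 1#} {G} {q * y - 1#} {H} {z * z - 1#}
               -- Half of λ₂ + λ₁ = 2b + 2k is b + k, so the parameter x of `closed` is y * z.
               (≈-trans (q^-≡ ([m+k+k+m]/2≡m+k b k)) (^-homo-* q b k))
               (-1-cong (q^[n+2] b)) (-1-cong (q^[n+1] b))
               (-1-cong (≈-trans (q^-≡ (ℕ.m+n∸m≡n b (k ℕ.+ k))) (^-homo-* q k k))) ⟩
        closed q (y * z) y (z * z) 1#
          ≈⟨ closed-cong q (y * z) y (z * z) (≈-reflexive (η-even 2∣b)) ⟨
        closed q (y * z) y (z * z) (η b) ∎))
    where
    open ≈-Reasoning
    a : ℕ
    a = b ℕ.+ (k ℕ.+ k)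
    z S F G H : Series
    z = q ^ k
    S = q ^ ((a ℕ.+ b) ℕ./ 2)
    F = q ^ (b ℕ.+ 2) - 1#
    G = q ^ (b ℕ.+ 1) - 1#
    H = q ^ (a ∸ b) - 1#

  C₂-odd : ∀ {n} → 2 ∤ b → ∃ (λ k → n ≡ k ℕ.+ k) → let a = b ℕ.+ n in
    K C₂ (weight a b) 0ʷ ≈ q ^ ((a ℕ.+ b) ℕ./ 2 ℕ.+ 1) *
      ( (q ^ (b ℕ.+ 1) - 1#) / (q ^ 2 - 1#)
      + q * ((q ^ (b ℕ.+ 1) - 1#) / (q - 1#)) * ((q ^ (a ∸ b) - 1#) / (q ^ 2 - 1#)) )
  C₂-odd 2∤b (k , refl) = ≈-trans (K-C₂ b (k ℕ.+ k))
    (≈-fractions (𝒦 2 (+ a , + b)) S q G G H (closed q (y * z) y (z * z) (η b))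
      (𝒦₂-closed b k) (begin
        cleared q S q G G H
          ≈⟨ cleared-cong q q {S} {q * (y * z)} {G} {q * y - 1#} {G} {q * y - 1#} {H} {z * z - 1#}
               (≈-trans (q^[n+1] ((a ℕ.+ b) ℕ./ 2))
                 (*-congˡ {q} (≈-trans (q^-≡ ([m+k+k+m]/2≡m+k b k)) (^-homo-* q b k))))
               (-1-cong (q^[n+1] b)) (-1-cong (q^[n+1] b))
               (-1-cong (≈-trans (q^-≡ (ℕ.m+n∸m≡n b (k ℕ.+ k))) (^-homo-* q k k))) ⟩
        cleared q (q * (y * z)) q (q * y - 1#) (q * y - 1#) (z * z - 1#)
          ≈⟨ closed₂-odd q (y * z) y (z * z) ⟩
        closed q (y * z) y (z * z) q
          ≈⟨ closed-cong q (y * z) y (z * z) (≈-reflexive (η-odd b 2∤b)) ⟨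
        closed q (y * z) y (z * z) (η b) ∎))
    where
    open ≈-Reasoning
    a : ℕ
    a = b ℕ.+ (k ℕ.+ k)
    z S G H : Series
    z = q ^ k
    S = q ^ ((a ℕ.+ b) ℕ./ 2 ℕ.+ 1)
    G = q ^ (b ℕ.+ 1) - 1#
    H = q ^ (a ∸ b) - 1#

  B₂-even : ∀ n → 2 ∣ n → let a = b ℕ.+ n in
    K B₂ (weight a b) 0ʷ ≈ q ^ a *
      ( (q ^ (2 ℕ.* b ℕ.+ 2) - 1#) / (q ^ 2 - 1#)
      + q ^ 2 * ((q ^ (2 ℕ.* b ℕ.+ 1) - 1#) / (q - 1#)) * ((q ^ (a ∸ b) - 1#) / (q ^ 2 - 1#)) )
  B₂-even n 2∣n = ≈-trans (K-B₂ b n)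
    (≈-fractions (𝒦 1 (+ a , + b)) (q ^ a) (q ^ 2) F G H (closed q (y * z) (y * y) z (η n))
      (𝒦₁-closed b n) (begin
        cleared q (q ^ a) (q ^ 2) F G H
          ≈⟨ cleared-cong q (q ^ 2)
               {q ^ a} {y * z} {F} {q ^ 2 * (y * y) - 1#} {G} {q * (y * y) - 1#} {H} {z - 1#}
               (^-homo-* q b n)
               (-1-cong (≈-trans (q^[n+2] (2 ℕ.* b)) (*-congˡ {q ^ 2} (q^2* b))))
               (-1-cong (≈-trans (q^[n+1] (2 ℕ.* b)) (*-congˡ {q} (q^2* b))))
               (-1-cong (q^-≡ (ℕ.m+n∸m≡n b n))) ⟩
        closed q (y * z) (y * y) z 1#
          ≈⟨ closed-cong q (y * z) (y * y) z (≈-reflexive (η-even 2∣n)) ⟨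
        closed q (y * z) (y * y) z (η n) ∎))
    where
    open ≈-Reasoning
    a : ℕ
    a = b ℕ.+ n
    z F G H : Series
    z = q ^ n
    F = q ^ (2 ℕ.* b ℕ.+ 2) - 1#
    G = q ^ (2 ℕ.* b ℕ.+ 1) - 1#
    H = q ^ (a ∸ b) - 1#

  B₂-odd : ∀ n → 2 ∤ n → let a = b ℕ.+ n in
    K B₂ (weight a b) 0ʷ ≈ q ^ (a ℕ.+ 1) * ((q ^ (2 ℕ.* b ℕ.+ 1) - 1#) / (q - 1#))
                                         * ((q ^ (a ∸ b ℕ.+ 1) - 1#) / (q ^ 2 - 1#))
  B₂-odd n 2∤n = ≈-trans (K-B₂ b n)
    (≈-triple (𝒦 1 (+ a , + b)) (q ^ (a ℕ.+ 1)) G H (closed q (y * z) (y * y) z (η n))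
      (𝒦₁-closed b n) (begin
        triple (q ^ (a ℕ.+ 1)) G H
          ≈⟨ triple-cong {q ^ (a ℕ.+ 1)} {q * (y * z)} {G} {q * (y * y) - 1#} {H} {q * z - 1#}
               (≈-trans (q^[n+1] a) (*-congˡ {q} (^-homo-* q b n)))
               (-1-cong (≈-trans (q^[n+1] (2 ℕ.* b)) (*-congˡ {q} (q^2* b))))
               (-1-cong (≈-trans (q^[n+1] (a ∸ b)) (*-congˡ {q} (q^-≡ (ℕ.m+n∸m≡n b n))))) ⟩
        triple (q * (y * z)) (q * (y * y) - 1#) (q * z - 1#)
          ≈⟨ closed₁-odd q (y * z) (y * y) z ⟩
        closed q (y * z) (y * y) z q
          ≈⟨ closed-cong q (y * z) (y * y) z (≈-reflexive (η-odd n 2∤n)) ⟨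
        closed q (y * z) (y * y) z (η n) ∎))
    where
    open ≈-Reasoning
    a : ℕ
    a = b ℕ.+ n
    z G H : Series
    z = q ^ n
    G = q ^ (2 ℕ.* b ℕ.+ 1) - 1#
    H = q ^ (a ∸ b ℕ.+ 1) - 1#

proposition5p2p1 :
    (λ₂ λ₁ : ℕ) → λ₁ ℕ.≤ λ₂ →
    ( ( 2 ∣ λ₂ × 2 ∣ λ₁ →
        K C₂ (weight λ₂ λ₁) 0ʷ ≈
          q ^ ((λ₂ ℕ.+ λ₁) ℕ./ 2) *
            ( (q ^ (λ₁ ℕ.+ 2) - 1#) / (q ^ 2 - 1#)
            + q ^ 2 * ((q ^ (λ₁ ℕ.+ 1) - 1#) / (q - 1#))
                    * ((q ^ (λ₂ ∸ λ₁) - 1#) / (q ^ 2 - 1#)) ) )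
    × ( 2 ∤ λ₂ × 2 ∤ λ₁ →
        K C₂ (weight λ₂ λ₁) 0ʷ ≈
          q ^ ((λ₂ ℕ.+ λ₁) ℕ./ 2 ℕ.+ 1) *
            ( (q ^ (λ₁ ℕ.+ 1) - 1#) / (q ^ 2 - 1#)
            + q * ((q ^ (λ₁ ℕ.+ 1) - 1#) / (q - 1#))
                * ((q ^ (λ₂ ∸ λ₁) - 1#) / (q ^ 2 - 1#)) ) )
    × ( ¬ (2 ∣ λ₂ × 2 ∣ λ₁) → ¬ (2 ∤ λ₂ × 2 ∤ λ₁) →
        K C₂ (weight λ₂ λ₁) 0ʷ ≈ 0# ) )
    ×
    ( ( 2 ∣ λ₂ ℕ.+ λ₁ →
        K B₂ (weight λ₂ λ₁) 0ʷ ≈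
          q ^ λ₂ *
            ( (q ^ (2 ℕ.* λ₁ ℕ.+ 2) - 1#) / (q ^ 2 - 1#)
            + q ^ 2 * ((q ^ (2 ℕ.* λ₁ ℕ.+ 1) - 1#) / (q - 1#))
                    * ((q ^ (λ₂ ∸ λ₁) - 1#) / (q ^ 2 - 1#)) ) )
    × ( 2 ∤ λ₂ ℕ.+ λ₁ →
        K B₂ (weight λ₂ λ₁) 0ʷ ≈
          q ^ (λ₂ ℕ.+ 1) * ((q ^ (2 ℕ.* λ₁ ℕ.+ 1) - 1#) / (q - 1#))
                         * ((q ^ (λ₂ ∸ λ₁ ℕ.+ 1) - 1#) / (q ^ 2 - 1#)) ) )
-- With λ₂ = λ₁ + n the cases are governed by n: λ₂ + λ₁ = 2λ₁ + n has the parity of n, and λ₂ and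
-- λ₁ have equal parity exactly when n is even.
proposition5p2p1 λ₂ λ₁ λ₁≤λ₂ = case ℕ.m≤n⇒∃[o]m+o≡n λ₁≤λ₂ of λ { (n , refl) →
    ( (λ (2∣λ₂ , 2∣λ₁) → C₂-even λ₁ 2∣λ₁ (even⇒double (∣m+n∣m⇒∣n 2∣λ₂ 2∣λ₁)))
    , (λ (2∤λ₂ , 2∤λ₁) → C₂-odd λ₁ 2∤λ₁ (even⇒double (odd-difference 2∤λ₂ 2∤λ₁)))
    , (λ ¬even ¬odd → ≈-trans (K-C₂ λ₁ n) (𝒦₂-odd λ₁ n (mixed-difference λ₁ ¬even ¬odd))) )
  , ( (λ 2∣ → B₂-even λ₁ n
        (∣m+n∣m⇒∣n (subst (2 ∣_) (m+n+m≡m*2+n λ₁ n) 2∣) (divides λ₁ refl)))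
    , (λ 2∤ → B₂-odd λ₁ n λ 2∣n →
        2∤ (subst (2 ∣_) (sym (m+n+m≡m*2+n λ₁ n)) (∣m∣n⇒∣m+n (divides λ₁ refl) 2∣n))) ) }
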